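{- A finite simple undirected graph $G$ is GaTEx if and only if every primitive induced subgraph of $G$ is a pseudo-cograph.
   Context: All graphs are finite, simple and undirected. A galled-tree on a finite nonempty set $X$ is a directed acyclic graph $N=(V,E)$ such that either $V=X=\{x\}$ and $E=\emptyset$, or: (N1) there is a unique root $\rho_N$ with indegree 0 and outdegree at least 2; (N2) $x\in X$ iff $x$ has outdegree 0 and indegree 1; (N3) every $v\in V\setminus X$ with $v\neq\rho_N$ has either indegree 1 and outdegree at least 2, or indegree 2 and outdegree at least 1 (hybrid-vertex); (N4) each biconnected component $C$ of $N$ contains at most one hybrid-vertex $v$ whose two in-neighbours both belong to $C$. For $x,y\in X$, $\mathrm{lca}_N(x,y)$ is the (in a galled-tree unique) minimal vertex, with respect to the ancestor order given by directed paths, that is an ancestor of both $x$ and $y$. A labeled galled-tree $(N,t)$ has a labeling $t:V\to\{0,1,\odot\}$ with $t(x)=\odot$ iff $x\in X$; it explains the graph on $X$ in which $\{x,y\}$ is an edge iff $t(\mathrm{lca}_N(x,y))=1$. A graph is GaTEx if it is isomorphic to a graph explained by some labeled galled-tree. A graph is primitive if it has at least four vertices and its only modules are the singletons and the whole vertex set, where a module is a vertex set $M$ with $N(x)\setminus M=N(y)\setminus M$ for all $x,y\in M$. A cograph is a graph with no induced path on four vertices. A graph $G$ is a pseudo-cograph if $|V(G)|\le 2$ or there are induced subgraphs $G_1,G_2$ of $G$ and a vertex $v$ such that (P1) $V(G)=V(G_1)\cup V(G_2)$, $V(G_1)\cap V(G_2)=\{v\}$, $|V(G_1)|>1$, $|V(G_2)|>1$;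 (P2) $G_1$ and $G_2$ are cographs; (P3) $G-v$ is either the join or the disjoint union of $G_1-v$ and $G_2-v$. -}

module Defs where

open import Data.Nat using (ℕ; zero; suc; _+_; _≤_)
open import Data.Fin using (Fin; zero; suc)
open import Data.Bool using (Bool; true; false; if_then_else_)
open import Data.Product using (Σ; ∃; _×_; _,_)
open import Data.Sum using (_⊎_)
open import Relation.Binary.PropositionalEquality using (_≡_; _≢_)
open import Relation.Nullary using (¬_; yes; no)
open import Data.Fin using (_≟_)
open import Function using (_∘_)
open import Function.Definitions using (Injective)
open import Function.Bundles using (_⇔_)

count : ∀ {k} → (Fin k → Bool) → ℕ
count {zero}  p = 0
count {suc k} p = (if p zero then 1 else 0) + count (p ∘ suc)

record Graph (n : ℕ) : Set where
  field
    adj    : Fin n → Fin n → Bool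
    sym    : ∀ i j → adj i j ≡ adj j i
    irrefl : ∀ i → adj i i ≡ false
open Graph public

-- induced subgraph of G on the image of f (f is required to be injective
-- wherever this is used)
induced : ∀ {n m} → Graph n → (Fin m → Fin n) → Graph m
induced G f = record
  { adj    = λ i j → adj G (f i) (f j)
  ; sym    = λ i j → sym G (f i) (f j)
  ; irrefl = λ i → irrefl G (f i)
  }

Embedding : ℕ → ℕ → Set
Embedding m n = Σ (Fin m → Fin n) (Injective _≡_ _≡_)

InImage : ∀ {m n} → (Fin m → Fin n) → Fin n → Set
InImage f x = ∃ λ i → f i ≡ x

IsModule : ∀ {n} → Graph n → (Fin n → Bool) → Set
IsModule G M = ∀ x y z → M x ≡ true → M y ≡ true → M z ≡ false →
               adj G x z ≡ adj G y z

Primitive : ∀ {n} → Graph n → Set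
Primitive {n} G = 4 ≤ n ×
  (∀ M → IsModule G M → count M ≤ 1 ⊎ (∀ v → M v ≡ true))

InducedP4 : ∀ {n} → Graph n → (Fin 4 → Fin n) → Set
InducedP4 G f =
  adj G (f v0) (f v1) ≡ true  × adj G (f v1) (f v2) ≡ true  ×
  adj G (f v2) (f v3) ≡ true  × adj G (f v0) (f v2) ≡ false ×
  adj G (f v0) (f v3) ≡ false × adj G (f v1) (f v3) ≡ false
  where
  v0 v1 v2 v3 : Fin 4
  v0 = zero
  v1 = suc zero
  v2 = suc (suc zero)
  v3 = suc (suc (suc zero))

Cograph : ∀ {n} → Graph n → Set
Cograph {n} G = ∀ (f : Fin 4 → Fin n) → Injective _≡_ _≡_ f → ¬ InducedP4 G f

-- Pseudo-cographs
-- G1, G2 are the induced subgraphs on the images of injections f1, f2.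

PseudoCograph : ∀ {n} → Graph n → Set
PseudoCograph {n} G = n ≤ 2 ⊎
  (Σ ℕ λ m₁ → Σ (Embedding m₁ n) λ { (f₁ , _) →
   Σ ℕ λ m₂ → Σ (Embedding m₂ n) λ { (f₂ , _) →
   Σ (Fin n) λ v →
     (∀ x → InImage f₁ x ⊎ InImage f₂ x) ×
     InImage f₁ v × InImage f₂ v ×
     (∀ x → InImage f₁ x → InImage f₂ x → x ≡ v) ×
     2 ≤ m₁ × 2 ≤ m₂ ×
     Cograph (induced G f₁) × Cograph (induced G f₂) ×
     -- (P3): G - v is the join, or the disjoint union, of G1 - v and G2 - v
     ((∀ x y → InImage f₁ x → x ≢ v → InImage f₂ y → y ≢ v → adj G x y ≡ true)
      ⊎
      (∀ x y → InImage f₁ x → x ≢ v → InImage f₂ y → y ≢ v → adj G x y ≡ false)) }})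

DEdges : ℕ → Set
DEdges k = Fin k → Fin k → Bool

indeg : ∀ {k} → DEdges k → Fin k → ℕ
indeg E v = count (λ u → E u v)

outdeg : ∀ {k} → DEdges k → Fin k → ℕ
outdeg E u = count (λ v → E u v)

data Path {k} (E : DEdges k) : Fin k → Fin k → Set where
  here  : ∀ {u} → Path E u u
  there : ∀ {u v w} → E u v ≡ true → Path E v w → Path E u w

Acyclic : ∀ {k} → DEdges k → Set
Acyclic E = ∀ u v → E u v ≡ true → ¬ Path E v u

data UPath {k} (E : DEdges k) (S : Fin k → Bool) : Fin k → Fin k → Set where
  here  : ∀ {u} → S u ≡ true → UPath E S u u
  there : ∀ {u v w} → S u ≡ true → (E u v ≡ true ⊎ E v u ≡ true) →
          UPath E S v w → UPath E S u w

ConnectedOn : ∀ {k} → DEdges k → (Fin k → Bool) → Set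
ConnectedOn E S = ∀ u w → S u ≡ true → S w ≡ true → UPath E S u w

remove : ∀ {k} → (Fin k → Bool) → Fin k → (Fin k → Bool)
remove S v u with u ≟ v
... | yes _ = false
... | no  _ = S u

Biconnected : ∀ {k} → DEdges k → (Fin k → Bool) → Set
Biconnected E S = ConnectedOn E S × (∀ v → S v ≡ true → ConnectedOn E (remove S v))

_⊆B_ : ∀ {k} → (Fin k → Bool) → (Fin k → Bool) → Set
S ⊆B T = ∀ u → S u ≡ true → T u ≡ true

BiconnectedComponent : ∀ {k} → DEdges k → (Fin k → Bool) → Set
BiconnectedComponent E C = (∃ λ u → C u ≡ true) × Biconnected E C ×
  (∀ C' → Biconnected E C' → C ⊆B C' → C' ⊆B C)

-- Galled-trees.  The network has vertex set Fin k, edge relation E, and its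
-- leaf set X is the image of the injection ℓ : Fin n → Fin k (so X ≅ Fin n).

GalledTree : ∀ {k n} → DEdges k → (Fin n → Fin k) → Set
GalledTree {k} {n} E ℓ =
  Injective _≡_ _≡_ ℓ × 1 ≤ n × Acyclic E ×
  (
    (n ≡ 1 × (∀ v → InImage ℓ v) × (∀ u v → E u v ≡ false))
  ⊎
    (
      (Σ (Fin k) λ ρ → indeg E ρ ≡ 0 × 2 ≤ outdeg E ρ ×
         (∀ u → indeg E u ≡ 0 → u ≡ ρ) ×
         (∀ v → ¬ InImage ℓ v → v ≢ ρ →
            (indeg E v ≡ 1 × 2 ≤ outdeg E v) ⊎ (indeg E v ≡ 2 × 1 ≤ outdeg E v)))
    ×
      (∀ x → InImage ℓ x ⇔ (outdeg E x ≡ 0 × indeg E x ≡ 1))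
    ×
      (∀ C → BiconnectedComponent E C → ∀ h h' →
         indeg E h ≡ 2 → C h ≡ true → (∀ u → E u h ≡ true → C u ≡ true) →
         indeg E h' ≡ 2 → C h' ≡ true → (∀ u → E u h' ≡ true → C u ≡ true) →
         h ≡ h')))

IsLCA : ∀ {k} → DEdges k → Fin k → Fin k → Fin k → Set
IsLCA E x y w = Path E w x × Path E w y ×
  (∀ w' → Path E w' x → Path E w' y → Path E w w' → w' ≡ w)

data Label : Set where
  l0 l1 l⊙ : Label

-- G is GaTEx: G is (isomorphic, via ℓ, to) the graph on the leaf set
-- explained by some labeled galled-tree.
GaTEx : ∀ {n} → Graph n → Set
GaTEx {n} G =
  Σ ℕ λ k → Σ (DEdges k) λ E → Σ (Fin n → Fin k) λ ℓ → Σ (Fin k → Label) λ t →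
    GalledTree E ℓ ×
    (∀ v → t v ≡ l⊙ ⇔ InImage ℓ v) ×
    (∀ i j → i ≢ j → ∀ w → IsLCA E (ℓ i) (ℓ j) w →
       adj G i j ≡ true ⇔ t w ≡ l1)

{-# OPTIONS --safe #-}
-- From networks to graphs: two biconnected sets with two common vertices have
-- a biconnected union, so by (N4) distinct galled cycles share at most one
-- vertex.  Hence below the top v of a galled cycle every leaf hangs from exactly
-- one cycle vertex, and the cycle is entered from above only through v.  Take v
-- lowest above all leaves of a primitive induced subgraph H.  Two children of v
-- must have common leaves, as otherwise H would be a join or a disjoint union;
-- this gives a cycle.  Leaves hanging from one cycle vertex form a module, so at
-- most one leaf of H hangs from each.  The two sides of the cycle, each together
-- with the leaf at the hybrid, are the two cographs.
--
-- From graphs to networks: a nontrivial module M is handled by gluing a network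
-- for G[M] to a leaf of one for the quotient, which is an induced subgraph.
-- Without nontrivial modules G is primitive, hence a pseudo-cograph.  A P4-free
-- graph with at least two vertices has a bipartition with uniform adjacency
-- across; in either of the two cographs the part avoiding the common vertex v is
-- a module of G, hence a singleton.  Splitting repeatedly orders both cographs
-- along the sides of a galled cycle with v below its hybrid.
module Submission where

open import Defs renaming (sym to adj-sym; irrefl to adj-irrefl)
open import Data.Nat using (ℕ; zero; suc; _+_; _≤_; _<_; z≤n; s≤s; s≤s⁻¹)
import Data.Nat.Properties as ℕ
open import Data.Fin using (Fin; zero; suc; _≟_; toℕ; fromℕ; inject₁; punchIn; punchOut)
import Data.Fin.Properties as Fin
import Data.Fin.Induction as Fin
open import Data.Fin.Relation.Unary.Top using (view; ‵fromℕ; ‵inject₁)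
open import Data.Fin.Subset.Properties using (anySubset?)
open import Data.Bool using (Bool; true; false; not; if_then_else_)
import Data.Bool as Bool
open import Data.Maybe using (Maybe; just; nothing)
import Data.Maybe as Maybe
open import Data.Maybe.Properties using (just-injective) renaming (≡-dec to Maybe-≡-dec)
open import Data.Vec using (lookup; tabulate)
open import Data.Vec.Properties using (lookup∘tabulate)
open import Data.Product using (Σ; ∃; _×_; _,_; proj₁; proj₂)
open import Data.Sum using (_⊎_; inj₁; inj₂; [_,_]′)
import Data.Sum as Sum
open import Data.Sum.Properties using (inj₁-injective; inj₂-injective)
open import Data.Sum.Function.Propositional using (_⊎-↔_)
open import Data.Empty using (⊥; ⊥-elim)
open import Function using (_∘_; id; flip)
open import Function.Definitions using (Injective)
open import Function.Bundles using (_⇔_; mk⇔; Equivalence; _↔_; mk↔ₛ′; Inverse)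
open import Function.Construct.Composition using (_↔-∘_)
open import Function.Construct.Symmetry using (↔-sym)
open import Function.Properties.Inverse using (↔⇒↣)
open import Induction.WellFounded using (WellFounded; Acc; acc)
open import Relation.Binary using (DecidableEquality; IsStrictPartialOrder; tri<; tri≈; tri>)
open import Relation.Nullary using (¬_; Dec; yes; no; does; contradiction)
open import Relation.Nullary.Decidable using (¬?; _⊎-dec_; _×-dec_; _→-dec_; map′; decidable-stable; via-injection)
open import Relation.Binary.PropositionalEquality using (_≡_; _≢_; refl; sym; trans; cong; cong₂; subst; isEquivalence; resp₂)

-- (N4) speaks of maximal biconnected sets, which are awkward to exhibit. The proof never computes a
-- component of a given network. It extends (N4) to arbitrary biconnected sets and then builds small
-- ones by hand: a cycle, a cycle with an ear, the union of two cycles. That a cycle vertex other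
-- than top and hybrid has one parent, and that hanging points are unique, both come from a second
-- hybrid in such a set.
--
-- Primitivity enters in two forms: a module that misses a vertex has at most one element, and no
-- bipartition into nonempty parts has uniform adjacency across.
--
-- A leaf below a cycle vertex sees all leaves that hang further down its side through one label.
-- Hence the topmost of any four leaves on a side is uniform to the other three, which excludes a
-- P4; conversely, a side can be rebuilt from any ordering in which each vertex is uniform to its
-- successors. The hybrid lies below both sides, so the leaf there is the vertex that the two
-- cographs share.

true≢false : true ≢ false
true≢false ()

¬true⇒false : ∀ {b} → ¬ b ≡ true → b ≡ false
¬true⇒false {true}  b≢t = contradiction refl b≢t
¬true⇒false {false} _   = refl

dec-bool : ∀ b → (b ≡ true) ⊎ (b ≡ false)
dec-bool true  = inj₁ refl
dec-bool false = inj₂ refl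

does⁻ : ∀ {a} {A : Set a} (A? : Dec A) → does A? ≡ true → A
does⁻ (yes a) _ = a

does⁺ : ∀ {a} {A : Set a} (A? : Dec A) → A → does A? ≡ true
does⁺ (yes _) _ = refl
does⁺ (no ¬a) a = contradiction a ¬a

does-false⁻ : ∀ {a} {A : Set a} (A? : Dec A) → does A? ≡ false → ¬ A
does-false⁻ (no ¬a) _ = ¬a

does-false⁺ : ∀ {a} {A : Set a} (A? : Dec A) → ¬ A → does A? ≡ false
does-false⁺ (yes a) ¬a = contradiction a ¬a
does-false⁺ (no _)  _  = refl

⇔true⇒≡ : ∀ {a b} → (a ≡ true → b ≡ true) → (b ≡ true → a ≡ true) → a ≡ b
⇔true⇒≡ {true}  {b}     f g = sym (f refl)
⇔true⇒≡ {false} {true}  f g = g refl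
⇔true⇒≡ {false} {false} f g = refl

remove⁺ : ∀ {k} (S : Fin k → Bool) v u → S u ≡ true → u ≢ v → remove S v u ≡ true
remove⁺ S v u Su u≢v with u ≟ v
... | yes u≡v = contradiction u≡v u≢v
... | no  _   = Su

remove⁻ : ∀ {k} (S : Fin k → Bool) v u → remove S v u ≡ true → S u ≡ true × u ≢ v
remove⁻ S v u r with u ≟ v
remove⁻ S v u () | yes _
... | no u≢v = r , u≢v

-- Counting

count-cong : ∀ {k} {p q : Fin k → Bool} → (∀ i → p i ≡ q i) → count p ≡ count q
count-cong {zero}  eq = refl
count-cong {suc k} eq rewrite eq zero = cong (_ +_) (count-cong (eq ∘ suc))

count-none : ∀ {k} {p : Fin k → Bool} → (∀ i → p i ≡ false) → count p ≡ 0
count-none {zero}  none = refl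
count-none {suc k} none rewrite none zero = count-none (none ∘ suc)

count-remove : ∀ {k} (p : Fin k → Bool) a → p a ≡ true → count p ≡ suc (count (remove p a))
count-remove p zero pa rewrite pa = cong suc (count-cong {p = p ∘ suc} λ _ → refl)
count-remove p (suc a) pa = trans
  (trans (cong (b +_) (count-remove (p ∘ suc) a pa)) (ℕ.+-suc b _))
  (cong suc (cong (b +_) (count-cong same)))
  where
  b : ℕ
  b = if p zero then 1 else 0
  same : ∀ i → remove (p ∘ suc) a i ≡ remove p (suc a) (suc i)
  same i = ⇔true⇒≡
    (λ r → let pi , i≢a = remove⁻ (p ∘ suc) a i r in
           remove⁺ p (suc a) (suc i) pi (i≢a ∘ Fin.suc-injective))
    (λ r → let pi , i≢a = remove⁻ p (suc a) (suc i) r in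
           remove⁺ (p ∘ suc) a i pi (i≢a ∘ cong suc))

count-mono : ∀ {k} {p q : Fin k → Bool} → p ⊆B q → count p ≤ count q
count-mono {zero} sub = z≤n
count-mono {suc k} {p} {q} sub with p zero in eq
... | true rewrite sub zero eq = s≤s (count-mono (sub ∘ suc))
... | false = ℕ.≤-trans (count-mono (sub ∘ suc)) (ℕ.m≤n+m _ _)

count-mono-< : ∀ {k} {p q : Fin k → Bool} a → p ⊆B q → p a ≡ false → q a ≡ true → count p < count q
count-mono-< {p = p} {q} a sub pa qa = subst (count p <_) (sym (count-remove q a qa))
  (s≤s (count-mono {p = p} λ u pu → remove⁺ q a u (sub u pu) λ { refl → true≢false (trans (sym pu) pa) }))

count-all : ∀ {k} {p : Fin k → Bool} → (∀ i → p i ≡ true) → count p ≡ k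
count-all {zero}  all = refl
count-all {suc k} all rewrite all zero = cong suc (count-all (all ∘ suc))

count≤k : ∀ {k} (p : Fin k → Bool) → count p ≤ k
count≤k p = subst (count p ≤_) (count-all {p = λ _ → true} λ _ → refl) (count-mono {p = p} {q = λ _ → true} λ _ _ → refl)

count-compl : ∀ {k} (p : Fin k → Bool) → count p + count (not ∘ p) ≡ k
count-compl {zero}  p = refl
count-compl {suc k} p with p zero
... | true  = cong suc (count-compl (p ∘ suc))
... | false = trans (ℕ.+-suc _ _) (cong suc (count-compl (p ∘ suc)))

1≤count : ∀ {k} {p : Fin k → Bool} a → p a ≡ true → 1 ≤ count p
1≤count {p = p} a pa rewrite count-remove p a pa = s≤s z≤n

2≤count : ∀ {k} {p : Fin k → Bool} {a b} → p a ≡ true → p b ≡ true → a ≢ b → 2 ≤ count p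
2≤count {p = p} {a} {b} pa pb a≢b rewrite count-remove p a pa =
  s≤s (1≤count {p = remove p a} b (remove⁺ p a b pb (a≢b ∘ sym)))

1≤count⁻ : ∀ {k} (p : Fin k → Bool) → 1 ≤ count p → ∃ λ a → p a ≡ true
1≤count⁻ p 1≤c with Fin.any? (λ a → p a Data.Bool.≟ true)
... | yes found = found
... | no none with () ← subst (1 ≤_) (count-none λ i → ¬true⇒false λ pi → none (i , pi)) 1≤c

2≤count⁻ : ∀ {k} (p : Fin k → Bool) → 2 ≤ count p →
           ∃ λ a → ∃ λ b → p a ≡ true × p b ≡ true × a ≢ b
2≤count⁻ p 2≤c with 1≤count⁻ p (ℕ.≤-trans (s≤s z≤n) 2≤c)
... | a , pa with 1≤count⁻ (remove p a) (s≤s⁻¹ (subst (2 ≤_) (count-remove p a pa) 2≤c))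
...   | b , rb with remove⁻ p a b rb
...     | pb , b≢a = a , b , pa , pb , b≢a ∘ sym

count≤1⁻ : ∀ {k} {p : Fin k → Bool} {a b} → count p ≤ 1 → p a ≡ true → p b ≡ true → a ≡ b
count≤1⁻ {a = a} {b} c≤1 pa pb with a ≟ b
... | yes a≡b = a≡b
... | no  a≢b = contradiction (ℕ.≤-trans (2≤count pa pb a≢b) c≤1) λ { (s≤s ()) }

count≡2⁻ : ∀ {k} {p : Fin k → Bool} {a b c} → count p ≡ 2 → p a ≡ true → p b ≡ true →
           a ≢ b → p c ≡ true → c ≡ a ⊎ c ≡ b
count≡2⁻ {p = p} {a} {b} {c} c≡2 pa pb a≢b pc with c ≟ a
... | yes c≡a = inj₁ c≡a
... | no  c≢a = inj₂ (count≤1⁻ {p = remove p a}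
        (ℕ.≤-reflexive (ℕ.suc-injective (trans (sym (count-remove p a pa)) c≡2)))
        (remove⁺ p a c pc c≢a) (remove⁺ p a b pb (a≢b ∘ sym)))

count≡0⁻ : ∀ {k} {p : Fin k → Bool} {a} → count p ≡ 0 → p a ≢ true
count≡0⁻ {p = p} {a} c≡0 pa with () ← subst (1 ≤_) c≡0 (1≤count {p = p} a pa)

-- Turns a Boolean vertex set into an `Embedding`, the form in which induced subgraphs and
-- pseudo-cographs take their vertex sets.
enum : ∀ {n} (p : Fin n → Bool) → Fin (count p) → Fin n
enum {suc n} p i with p zero
enum {suc n} p zero    | true  = zero
enum {suc n} p (suc i) | true  = suc (enum (p ∘ suc) i)
enum {suc n} p i       | false = suc (enum (p ∘ suc) i)

enum-injective : ∀ {n} (p : Fin n → Bool) → Injective _≡_ _≡_ (enum p)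
enum-injective {suc n} p {i} {j} eq with p zero
enum-injective {suc n} p {zero}  {zero}  eq | true  = refl
enum-injective {suc n} p {suc i} {suc j} eq | true  = cong suc (enum-injective (p ∘ suc) (Fin.suc-injective eq))
enum-injective {suc n} p {i}     {j}     eq | false = enum-injective (p ∘ suc) (Fin.suc-injective eq)

enum-sound : ∀ {n} (p : Fin n → Bool) i → p (enum p i) ≡ true
enum-sound {suc n} p i with p zero in eq
enum-sound {suc n} p zero    | true  = eq
enum-sound {suc n} p (suc i) | true  = enum-sound (p ∘ suc) i
enum-sound {suc n} p i       | false = enum-sound (p ∘ suc) i

enum-complete : ∀ {n} (p : Fin n → Bool) x → p x ≡ true → InImage (enum p) x
enum-complete {suc n} p x px with p zero in eq
enum-complete {suc n} p zero    px | true  = zero , refl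
enum-complete {suc n} p (suc x) px | true  =
  let i , e = enum-complete (p ∘ suc) x px in suc i , cong suc e
enum-complete {suc n} p zero    px | false = contradiction (trans (sym px) eq) true≢false
enum-complete {suc n} p (suc x) px | false =
  let i , e = enum-complete (p ∘ suc) x px in i , cong suc e

-- Directed paths, undirected walks and biconnected sets

module Walks where

  private variable
    k : ℕ
    E : DEdges k
    S T : Fin k → Bool
    u v w x y z : Fin k

  infixr 5 _++_
  _++_ : Path E u v → Path E v w → Path E u w
  here      ++ q = q
  there e p ++ q = there e (p ++ q)

  edge : E u v ≡ true → Path E u v
  edge e = there e here

  On : {E : DEdges k} {u w : Fin k} → Fin k → Path E u w → Set
  On z (here {u})      = z ≡ u
  On z (there {u} _ p) = z ≡ u ⊎ On z p

  on? : ∀ z (p : Path E u w) → Dec (On z p)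
  on? z (here {u})      = z ≟ u
  on? z (there {u} _ p) = (z ≟ u) ⊎-dec on? z p

  on-start : (p : Path E u w) → On u p
  on-start here        = refl
  on-start (there _ _) = inj₁ refl

  on-end : (p : Path E u w) → On w p
  on-end here        = refl
  on-end (there _ p) = inj₂ (on-end p)

  prefix : (p : Path E u w) → On z p → Path E u z
  prefix here        refl        = here
  prefix (there e p) (inj₁ refl) = here
  prefix (there e p) (inj₂ o)    = there e (prefix p o)

  suffix : (p : Path E u w) → On z p → Path E z w
  suffix here        refl        = here
  suffix (there e p) (inj₁ refl) = there e p
  suffix (there e p) (inj₂ o)    = suffix p o

  prefix-⊆ : (p : Path E u w) (o : On z p) → On y (prefix p o) → On y p
  prefix-⊆ here        refl        oy          = oy
  prefix-⊆ (there e p) (inj₁ refl) oy          = inj₁ oy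
  prefix-⊆ (there e p) (inj₂ o)    (inj₁ refl) = inj₁ refl
  prefix-⊆ (there e p) (inj₂ o)    (inj₂ oy)   = inj₂ (prefix-⊆ p o oy)

  suffix-⊆ : (p : Path E u w) (o : On z p) → On y (suffix p o) → On y p
  suffix-⊆ here        refl        oy = oy
  suffix-⊆ (there e p) (inj₁ refl) oy = oy
  suffix-⊆ (there e p) (inj₂ o)    oy = inj₂ (suffix-⊆ p o oy)

  on-++ : (p : Path E u v) (q : Path E v w) → On z (p ++ q) → On z p ⊎ On z q
  on-++ here        q o        = inj₂ o
  on-++ (there e p) q (inj₁ o) = inj₁ (inj₁ o)
  on-++ (there e p) q (inj₂ o) = Sum.map₁ inj₂ (on-++ p q o)

  on-comparable : (p : Path E u w) → On y p → On z p → Path E y z ⊎ Path E z y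
  on-comparable here        refl        refl        = inj₁ here
  on-comparable (there e p) (inj₁ refl) oz          = inj₁ (prefix (there e p) oz)
  on-comparable (there e p) (inj₂ oy)   (inj₁ refl) = inj₂ (prefix (there e p) (inj₂ oy))
  on-comparable (there e p) (inj₂ oy)   (inj₂ oz)   = on-comparable p oy oz

  on-successor : (p : Path E u w) → On z p → z ≡ w ⊎ ∃ λ y → E z y ≡ true × On y p
  on-successor here        refl        = inj₁ refl
  on-successor (there e p) (inj₁ refl) = inj₂ (_ , e , inj₂ (on-start p))
  on-successor (there e p) (inj₂ o)    = Sum.map₂ (λ (y , e , o) → y , e , inj₂ o) (on-successor p o)

  on-predecessor : (p : Path E u w) → On z p → z ≡ u ⊎ ∃ λ y → E y z ≡ true × On y p
  on-predecessor here        refl        = inj₁ refl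
  on-predecessor (there e p) (inj₁ refl) = inj₁ refl
  on-predecessor (there e p) (inj₂ o) with on-predecessor p o
  ... | inj₁ refl          = inj₂ (_ , e , inj₁ refl)
  ... | inj₂ (y , e′ , oy) = inj₂ (y , e′ , inj₂ oy)

  -- With `D` a cycle, this finds the vertex at which a path finally leaves it; with `D` another
  -- path, the last vertex that the two have in common.
  lastHit : {E : DEdges k} {u x : Fin k} {D : Fin k → Set} → (∀ z → Dec (D z)) → (p : Path E u x) →
            (∃ λ w → D w × Path E u w × Σ (Path E w x) λ q →
               (∀ z → On z q → D z → z ≡ w) × (∀ z → On z q → On z p))
            ⊎ (∀ z → On z p → ¬ D z)
  lastHit D? (here {u}) with D? u
  ... | yes d = inj₁ (u , d , here , here , (λ _ o _ → o) , λ _ o → o)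
  ... | no ¬d = inj₂ λ { _ refl → ¬d }
  lastHit D? (there {u} e p) with lastHit D? p
  ... | inj₁ (w , d , r , q , only , q⊆p) = inj₁ (w , d , there e r , q , only , λ z → inj₂ ∘ q⊆p z)
  ... | inj₂ none with D? u
  ...   | yes d = inj₁ (u , d , here , there e p , only , λ _ o → o)
          where
          only : ∀ z → On z (there e p) → _ → z ≡ u
          only z (inj₁ z≡u) _  = z≡u
          only z (inj₂ o)   dz = contradiction dz (none z o)
  ...   | no ¬d = inj₂ λ { _ (inj₁ refl) → ¬d ; z (inj₂ o) → none z o }

  -- A path cut at its first vertex in `D` meets `D` only there, which is how ears and sides of
  -- cycles are obtained.
  firstHit : {E : DEdges k} {u x : Fin k} {D : Fin k → Set} → (∀ z → Dec (D z)) → (p : Path E u x) → D x →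
             ∃ λ w → D w × Σ (Path E u w) λ q →
               (∀ z → On z q → D z → z ≡ w) × (∀ z → On z q → On z p)
  firstHit D? here d = _ , d , here , (λ _ o _ → o) , λ _ o → o
  firstHit D? (there {u} e p) d with D? u
  ... | yes du = u , du , here , (λ _ o _ → o) , λ { _ refl → inj₁ refl }
  ... | no ¬du with firstHit D? p d
  ...   | w , dw , q , only , q⊆p = w , dw , there e q
          , (λ { _ (inj₁ refl) dz → contradiction dz ¬du ; z (inj₂ o) dz → only z o dz })
          , λ { _ (inj₁ refl) → inj₁ refl ; z (inj₂ o) → inj₂ (q⊆p z o) }

  -- Undirected walks

  UPath-start : UPath E S u w → S u ≡ true
  UPath-start (here s)      = s
  UPath-start (there s _ _) = s

  UPath-trans : UPath E S u v → UPath E S v w → UPath E S u w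
  UPath-trans (here _)      q = q
  UPath-trans (there s e p) q = there s e (UPath-trans p q)

  UPath-sym : UPath E S u w → UPath E S w u
  UPath-sym (here s) = here s
  UPath-sym (there s e p) =
    UPath-trans (UPath-sym p) (there (UPath-start p) (Sum.swap e) (here s))

  UPath-mono : S ⊆B T → UPath E S u w → UPath E T u w
  UPath-mono S⊆T (here s)      = here (S⊆T _ s)
  UPath-mono S⊆T (there s e p) = there (S⊆T _ s) e (UPath-mono S⊆T p)

  walk : (p : Path E u w) → (∀ z → On z p → T z ≡ true) → UPath E T u w
  walk here        on = here (on _ refl)
  walk (there e p) on = there (on _ (inj₁ refl)) (inj₁ e) (walk p (λ z → on z ∘ inj₂))

  ConnectedOn-via : ∀ a → (∀ z → T z ≡ true → UPath E T z a) → ConnectedOn E T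
  ConnectedOn-via a to u w Tu Tw = UPath-trans (to u Tu) (UPath-sym (to w Tw))

  -- `Biconnected` asks only for the removal of members. Removing a non-member changes nothing, so
  -- later cuts need no case distinction on `x`.
  remove-connected : Biconnected E S → ∀ x → ConnectedOn E (remove S x)
  remove-connected {S = S} (conn , cut) x with dec-bool (S x)
  ... | inj₁ Sx = cut x Sx
  ... | inj₂ ¬Sx = λ u w ru rw → UPath-mono
          (λ z Sz → remove⁺ S x z Sz λ { refl → true≢false (trans (sym Sz) ¬Sx) })
          (conn u w (proj₁ (remove⁻ S x u ru)) (proj₁ (remove⁻ S x w rw)))

  Biconnected-∪ : ∀ {U} → Biconnected E S → Biconnected E T → ∀ {a b} → a ≢ b →
                  S a ≡ true → S b ≡ true → T a ≡ true → T b ≡ true →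
                  S ⊆B U → T ⊆B U → (∀ z → U z ≡ true → S z ≡ true ⊎ T z ≡ true) →
                  Biconnected E U
  Biconnected-∪ {E = E} {S = S} {T = T} {U = U} bS bT {a} {b} a≢b Sa Sb Ta Tb S⊆U T⊆U U⊆ =
    ConnectedOn-via a whole , λ x _ → cut x
    where
    whole : ∀ z → U z ≡ true → UPath E U z a
    whole z Uz with U⊆ z Uz
    ... | inj₁ Sz = UPath-mono S⊆U (proj₁ bS z a Sz Sa)
    ... | inj₂ Tz = UPath-mono T⊆U (proj₁ bT z a Tz Ta)

    cut-via : ∀ x c → c ≢ x → S c ≡ true → T c ≡ true → ConnectedOn E (remove U x)
    cut-via x c c≢x Sc Tc = ConnectedOn-via c λ z rz →
      let Uz , z≢x = remove⁻ U x z rz in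
      [ (λ Sz → UPath-mono
            (λ y r → let Sy , y≢x = remove⁻ S x y r in remove⁺ U x y (S⊆U y Sy) y≢x)
            (remove-connected bS x z c (remove⁺ S x z Sz z≢x) (remove⁺ S x c Sc c≢x)))
      , (λ Tz → UPath-mono
            (λ y r → let Ty , y≢x = remove⁻ T x y r in remove⁺ U x y (T⊆U y Ty) y≢x)
            (remove-connected bT x z c (remove⁺ T x z Tz z≢x) (remove⁺ T x c Tc c≢x)))
      ]′ (U⊆ z Uz)

    cut : ∀ x → ConnectedOn E (remove U x)
    cut x with a ≟ x
    ... | no a≢x   = cut-via x a a≢x Sa Ta
    ... | yes refl = cut-via x b (a≢b ∘ sym) Sb Tb

  Biconnected-edge : E u v ≡ true → S u ≡ true → S v ≡ true →
                     (∀ z → S z ≡ true → z ≡ u ⊎ z ≡ v) → Biconnected E S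
  Biconnected-edge {E = E} {u} {v} {S} e Su Sv only = ConnectedOn-via v whole , λ x _ → cut x
    where
    whole : ∀ z → S z ≡ true → UPath E S z v
    whole z Sz with only z Sz
    ... | inj₁ refl = there Su (inj₁ e) (here Sv)
    ... | inj₂ refl = here Sv
    cut : ∀ x → ConnectedOn E (remove S x)
    cut x a b ra rb with remove⁻ S x a ra | remove⁻ S x b rb
    ... | Sa , a≢x | Sb , b≢x with only a Sa | only b Sb
    ... | inj₁ refl | inj₁ refl = here ra
    ... | inj₁ refl | inj₂ refl = there ra (inj₁ e) (here rb)
    ... | inj₂ refl | inj₁ refl = there ra (inj₂ e) (here rb)
    ... | inj₂ refl | inj₂ refl = here ra

  -- Reachability and ears in acyclic digraphs

  module Dag {k : ℕ} (E : DEdges k) (acyclic : Acyclic E) where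

    antisym : Path E u w → Path E w u → u ≡ w
    antisym here        q = refl
    antisym (there e p) q = contradiction (p ++ q) (acyclic _ _ e)

    _⊏_ : Fin k → Fin k → Set
    u ⊏ w = ∃ λ v → E u v ≡ true × Path E v w

    ⊏-isStrictPartialOrder : IsStrictPartialOrder _≡_ _⊏_
    ⊏-isStrictPartialOrder = record
      { isEquivalence = isEquivalence
      ; irrefl        = λ { refl (v , e , p) → acyclic _ _ e p }
      ; trans         = λ (v , e , p) (v′ , e′ , p′) → v , e , p ++ there e′ p′
      ; <-resp-≈      = resp₂ _⊏_
      }

    -- Serves recursion towards the root, `⊏-noetherian` recursion towards the leaves.
    ⊏-wellFounded : WellFounded _⊏_
    ⊏-wellFounded = Fin.spo-wellFounded ⊏-isStrictPartialOrder

    ⊏-noetherian : WellFounded (flip _⊏_)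
    ⊏-noetherian = Fin.spo-noetherian ⊏-isStrictPartialOrder

    edge-≢ : E u w ≡ true → u ≢ w
    edge-≢ e refl = acyclic _ _ e here

    path? : ∀ u w → Dec (Path E u w)
    path? u w = go u (⊏-noetherian u)
      where
      go : ∀ u → Acc (flip _⊏_) u → Dec (Path E u w)
      step : ∀ u → Acc (flip _⊏_) u → ∀ v → Dec (E u v ≡ true × Path E v w)
      step u (acc rs) v with E u v in e
      ... | true  = map′ (refl ,_) proj₂ (go v (rs (v , e , here)))
      ... | false = no λ ()
      go u a with u ≟ w
      ... | yes refl = yes here
      ... | no  u≢w = map′ (λ (v , e , p) → there e p)
                           (λ { here → contradiction refl u≢w ; (there e p) → _ , e , p })
                           (Fin.any? (step u a))

    -- If x lies on p, the rest of p survives the removal of x in two pieces.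
    escape : (p : Path E u y) → (∀ z → On z p → S z ≡ true) → ∀ x z → On z p → z ≢ x →
             UPath E (remove S x) z u ⊎ (UPath E (remove S x) z y × On x p × x ≢ y)
    escape {S = S} here on x z refl z≢x = inj₁ (here (remove⁺ S x z (on _ refl) z≢x))
    escape {S = S} (there {u} e p) on x z (inj₁ refl) z≢x =
      inj₁ (here (remove⁺ S x z (on _ (inj₁ refl)) z≢x))
    escape {S = S} (there {u} e p) on x z (inj₂ o) z≢x with escape p (λ z → on z ∘ inj₂) x z o z≢x
    ... | inj₂ (down , ox , x≢y) = inj₂ (down , inj₂ ox , x≢y)
    ... | inj₁ up with u ≟ x
    ...   | no u≢x = inj₁ (UPath-trans up
              (there (UPath-start (UPath-sym up)) (inj₂ e) (here (remove⁺ S x u (on u (inj₁ refl)) u≢x))))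
    -- Here `x` is the start of the current piece. By acyclicity it does not occur again, so the
    -- rest down to `y` survives.
    ...   | yes refl = inj₂ (walk (suffix p o) (λ y oy → let oy′ = suffix-⊆ p o oy in
                remove⁺ S x y (on y (inj₂ oy′)) λ { refl → acyclic _ _ e (prefix p oy′) })
              , inj₁ refl , λ { refl → acyclic _ _ e p })

    -- The ear consists of two directed paths with feet `u` and `v` that meet in `y` only. A removed
    -- vertex other than `y` breaks at most one of them, and the piece cut off from its own foot
    -- reaches the other foot through `y`. Removing `y` leaves both pieces attached to their feet.
    ear : Biconnected E S → S u ≡ true → S v ≡ true → u ≢ v →
          (p : Path E u y) (q : Path E v y) → (∀ z → On z p → On z q → z ≡ y) →
          S ⊆B T → (∀ z → On z p → T z ≡ true) → (∀ z → On z q → T z ≡ true) →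
          (∀ z → T z ≡ true → S z ≡ true ⊎ On z p ⊎ On z q) → Biconnected E T
    ear {S = S} {u = u} {v = v} {y = y} {T = T} bS Su Sv u≢v p q disj S⊆T p⊆T q⊆T T⊆ =
      ConnectedOn-via u whole , λ x _ → cut x
      where
      whole : ∀ z → T z ≡ true → UPath E T z u
      whole z Tz with T⊆ z Tz
      ... | inj₁ Sz = UPath-mono S⊆T (proj₁ bS z u Sz Su)
      ... | inj₂ (inj₁ o) = UPath-sym (walk (prefix p o) λ y → p⊆T y ∘ prefix-⊆ p o)
      ... | inj₂ (inj₂ o) = UPath-trans (UPath-sym (walk (prefix q o) λ y → q⊆T y ∘ prefix-⊆ q o))
                              (UPath-mono S⊆T (proj₁ bS v u Sv Su))

      toS : ∀ x z → remove T x z ≡ true →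
            ∃ λ s → S s ≡ true × s ≢ x × UPath E (remove T x) z s
      toS x z rz with remove⁻ T x z rz
      ... | Tz , z≢x with T⊆ z Tz
      ... | inj₁ Sz = z , Sz , z≢x , here rz
      ... | inj₂ (inj₁ o) with escape p p⊆T x z o z≢x
      ...   | inj₁ up = u , Su , proj₂ (remove⁻ T x u (UPath-start (UPath-sym up))) , up
      ...   | inj₂ (down , ox , x≢y) =
                v , Sv , avoid v (on-start q)
                , UPath-trans down (UPath-sym (walk q λ z o → remove⁺ T x z (q⊆T z o) (avoid z o)))
              where
              avoid : ∀ z → On z q → z ≢ x
              avoid z oz refl = x≢y (disj x ox oz)
      toS x z rz | Tz , z≢x | inj₂ (inj₂ o) with escape q q⊆T x z o z≢x
      ...   | inj₁ up = v , Sv , proj₂ (remove⁻ T x v (UPath-start (UPath-sym up))) , up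
      ...   | inj₂ (down , ox , x≢y) =
                u , Su , avoid u (on-start p)
                , UPath-trans down (UPath-sym (walk p λ z o → remove⁺ T x z (p⊆T z o) (avoid z o)))
              where
              avoid : ∀ z → On z p → z ≢ x
              avoid z oz refl = x≢y (disj x oz ox)

      cut : ∀ x → ConnectedOn E (remove T x)
      cut x a b ra rb with toS x a ra | toS x b rb
      ... | s , Ss , s≢x , as | t , St , t≢x , bt = UPath-trans as (UPath-trans
        (UPath-mono (λ y r → let Sy , y≢x = remove⁻ S x y r in remove⁺ T x y (S⊆T y Sy) y≢x)
          (remove-connected bS x s t (remove⁺ S x s Ss s≢x) (remove⁺ S x t St t≢x)))
        (UPath-sym bt))

open Walks

-- Hybrids in arbitrary biconnected sets

HybridIn : ∀ {k} → DEdges k → (Fin k → Bool) → Fin k → Set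
HybridIn E S h = indeg E h ≡ 2 × S h ≡ true × (∀ u → E u h ≡ true → S u ≡ true)

AtMostOneHybrid : ∀ {k} → DEdges k → Set
AtMostOneHybrid E = ∀ C → BiconnectedComponent E C → ∀ h h' →
         indeg E h ≡ 2 → C h ≡ true → (∀ u → E u h ≡ true → C u ≡ true) →
         indeg E h' ≡ 2 → C h' ≡ true → (∀ u → E u h' ≡ true → C u ≡ true) →
         h ≡ h'

-- Every biconnected set lies in a component, so (N4) applies to it. No maximal set is searched for:
-- if `h ≢ h′`, each strictly larger biconnected set is refuted by recursion, and this makes `S`
-- itself a component. `fuel` bounds the number of vertices outside `S`.
hybrid-unique : ∀ {k} (E : DEdges k) → AtMostOneHybrid E → ∀ {S h h′} → Biconnected E S →
                HybridIn E S h → HybridIn E S h′ → h ≡ h′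
hybrid-unique {k} E n4 {S} {h} {h′} bS hyb hyb′ =
  decidable-stable (h ≟ h′) λ h≢h′ → go h≢h′ k S (ℕ.m≤n+m k (count S)) bS hyb hyb′
  where
  -- A counterexample S that is not yet a component has a larger one above it.
  go : h ≢ h′ → ∀ fuel S → k ≤ count S + fuel → Biconnected E S →
       HybridIn E S h → HybridIn E S h′ → ⊥
  enlarge : h ≢ h′ → ∀ fuel S → k ≤ count S + fuel → HybridIn E S h → HybridIn E S h′ →
            ∀ C → Biconnected E C → S ⊆B C → C ⊆B S
  go h≢h′ fuel S k≤ bS hyb@(i , Sh , ps) hyb′@(i′ , Sh′ , ps′) =
    h≢h′ (n4 S ((h , Sh) , bS , enlarge h≢h′ fuel S k≤ hyb hyb′) h h′ i Sh ps i′ Sh′ ps′)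
  enlarge h≢h′ fuel S k≤ hyb hyb′ C bC S⊆C u Cu with dec-bool (S u)
  ... | inj₁ Su = Su
  enlarge h≢h′ zero S k≤ _ _ C bC S⊆C u Cu | inj₂ ¬Su = contradiction
    (ℕ.≤-<-trans (subst (k ≤_) (ℕ.+-identityʳ _) k≤)
      (ℕ.<-≤-trans (count-mono-< u S⊆C ¬Su Cu) (count≤k C))) (ℕ.<-irrefl refl)
  enlarge h≢h′ (suc fuel) S k≤ (i , Sh , ps) (i′ , Sh′ , ps′) C bC S⊆C u Cu | inj₂ ¬Su =
    ⊥-elim (go h≢h′ fuel C
      (ℕ.≤-trans (subst (k ≤_) (ℕ.+-suc _ _) k≤) (ℕ.+-monoˡ-≤ fuel (count-mono-< u S⊆C ¬Su Cu)))
      bC (i , S⊆C h Sh , λ v → S⊆C v ∘ ps v) (i′ , S⊆C h′ Sh′ , λ v → S⊆C v ∘ ps′ v))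

-- Galled cycles and what hangs below them

module GalledNetwork {k : ℕ} (E : DEdges k) (acyclic : Acyclic E)
  (ρ : Fin k) (from-root : ∀ v → Path E ρ v)
  (two-parents : ∀ {p q z} → E p z ≡ true → E q z ≡ true → p ≢ q → indeg E z ≡ 2)
  (n4 : AtMostOneHybrid E) where

  open Dag E acyclic

  private variable
    p q u v w x y z h : Fin k

  only-parents : E p z ≡ true → E q z ≡ true → p ≢ q → E y z ≡ true → y ≡ p ⊎ y ≡ q
  only-parents ep eq p≢q ey = count≡2⁻ (two-parents ep eq p≢q) ep eq p≢q ey

  -- A galled cycle from v to the hybrid h, cut open at v.
  record Gall (v h : Fin k) : Set where
    field
      {c₁ c₂} : Fin k
      e₁   : E v c₁ ≡ true
      e₂   : E v c₂ ≡ true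
      c₁≢c₂ : c₁ ≢ c₂
      side₁ : Path E c₁ h
      side₂ : Path E c₂ h
      meet : ∀ z → On z side₁ → On z side₂ → z ≡ h

  swap : Gall v h → Gall v h
  swap g = record { e₁ = e₂ ; e₂ = e₁ ; c₁≢c₂ = c₁≢c₂ ∘ sym
                  ; side₁ = side₂ ; side₂ = side₁ ; meet = λ z o o′ → meet z o′ o }
    where open Gall g

  Inside : Gall v h → Fin k → Set
  Inside {v} g z = z ≡ v ⊎ On z (Gall.side₁ g) ⊎ On z (Gall.side₂ g)

  inside? : (g : Gall v h) → ∀ z → Dec (Inside g z)
  inside? {v} g z = (z ≟ v) ⊎-dec (on? z (Gall.side₁ g) ⊎-dec on? z (Gall.side₂ g))

  inside : Gall v h → Fin k → Bool
  inside g z = does (inside? g z)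

  top≢ : E u v ≡ true → (P : Path E v w) → ¬ On u P
  top≢ e P o = acyclic _ _ e (prefix P o)

  -- The cycle is the edge from `v` to `c₁` with one ear: `side₁` with foot `c₁`, and `side₂`
  -- prolonged upwards to the foot `v`.
  inside-biconnected : (g : Gall v h) → Biconnected E (inside g)
  inside-biconnected {v} {h} g =
    ear {S = base} (Biconnected-edge e₁ (does⁺ (base? v) (inj₁ refl)) (does⁺ (base? c₁) (inj₂ refl)) λ z → does⁻ (base? z))
        (does⁺ (base? c₁) (inj₂ refl)) (does⁺ (base? v) (inj₁ refl)) (edge-≢ e₁ ∘ sym)
        side₁ (there e₂ side₂)
        (λ { z o (inj₁ refl) → contradiction o (top≢ e₁ side₁) ; z o (inj₂ o′) → meet z o o′ })
        (λ z b → [ (λ { refl → inC z (inj₁ refl) }) , (λ { refl → inC z (inj₂ (inj₁ (on-start side₁))) }) ]′ (does⁻ (base? z) b))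
        (λ z o → inC z (inj₂ (inj₁ o)))
        (λ { z (inj₁ refl) → inC z (inj₁ refl) ; z (inj₂ o) → inC z (inj₂ (inj₂ o)) })
        λ z c → [ (λ { refl → inj₁ (does⁺ (base? z) (inj₁ refl)) })
                , [ inj₂ ∘ inj₁ , (λ o → inj₂ (inj₂ (inj₂ o))) ]′ ]′ (does⁻ (inside? g z) c)
    where
    open Gall g
    base? : ∀ z → Dec (z ≡ v ⊎ z ≡ c₁)
    base? z = (z ≟ v) ⊎-dec (z ≟ c₁)
    base : Fin k → Bool
    base z = does (base? z)
    inC : ∀ z → Inside g z → inside g z ≡ true
    inC z = does⁺ (inside? g z)

  -- The first alternative is a side that consists of `h` alone, reached by an edge from the top.
  last-edge : E v w ≡ true → (P : Path E w h) → ∃ λ p → E p h ≡ true × (p ≡ v × w ≡ h ⊎ On p P)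
  last-edge e here = _ , e , inj₁ (refl , refl)
  last-edge e (there e′ P) with last-edge e′ P
  ... | p , ep , inj₁ (refl , _) = p , ep , inj₂ (inj₁ refl)
  ... | p , ep , inj₂ o          = p , ep , inj₂ (inj₂ o)

  gall-parents : (g : Gall v h) → ∃ λ p → ∃ λ q → E p h ≡ true × E q h ≡ true × p ≢ q ×
                 Inside g p × Inside g q
  gall-parents {v} {h} g with last-edge (Gall.e₁ g) (Gall.side₁ g) | last-edge (Gall.e₂ g) (Gall.side₂ g)
  ... | p , ep , op | q , eq , oq = p , q , ep , eq , differ op oq
      , [ inj₁ ∘ proj₁ , inj₂ ∘ inj₁ ]′ op , [ inj₁ ∘ proj₁ , inj₂ ∘ inj₂ ]′ oq
    where
    open Gall g
    differ : p ≡ v × c₁ ≡ h ⊎ On p side₁ → q ≡ v × c₂ ≡ h ⊎ On q side₂ → p ≢ q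
    differ (inj₁ (_ , c₁≡h))   (inj₁ (_ , c₂≡h))   _    = c₁≢c₂ (trans c₁≡h (sym c₂≡h))
    differ (inj₁ (refl , _))   (inj₂ o)            refl = top≢ e₂ side₂ o
    differ (inj₂ o)            (inj₁ (refl , _))   refl = top≢ e₁ side₁ o
    differ (inj₂ o)            (inj₂ o′)           refl = edge-≢ ep (meet p o o′)

  gall-hybrid : (g : Gall v h) → indeg E h ≡ 2 × (∀ u → E u h ≡ true → Inside g u)
  gall-hybrid g with gall-parents g
  ... | p , q , ep , eq , p≢q , ip , iq = two-parents ep eq p≢q ,
    λ u eu → [ (λ { refl → ip }) , (λ { refl → iq }) ]′ (only-parents ep eq p≢q eu)

  inside-h : (g : Gall v h) → Inside g h
  inside-h g = inj₂ (inj₁ (on-end (Gall.side₁ g)))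

  gall-in : (g : Gall v h) {S : Fin k → Bool} → (∀ z → Inside g z → S z ≡ true) → HybridIn E S h
  gall-in g sub = proj₁ (gall-hybrid g) , sub _ (inside-h g) , λ u e → sub u (proj₂ (gall-hybrid g) u e)

  -- The second path is cut where it first touches the first one, so that the sides share only their
  -- end.
  first-meeting : E v p ≡ true → E v q ≡ true → p ≢ q → Path E p x → Path E q x →
                  ∃ λ y → Σ (Gall v y) λ g → Gall.c₁ g ≡ p
  first-meeting e e′ p≢q P Q with firstHit (λ z → on? z P) Q (on-end P)
  ... | y , oy , Q′ , only , _ = y , record
    { e₁ = e ; e₂ = e′ ; c₁≢c₂ = p≢q ; side₁ = prefix P oy ; side₂ = Q′
    ; meet = λ z o o′ → only z o′ (prefix-⊆ P oy o) } , refl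

  -- Prolongs a path to a parent of `z` down to `z` and splits off its first edge, which gives one
  -- half of a `Gall`. The last component says that the half is a single edge only if the path was
  -- trivial.
  uncons-snoc : (P : Path E w p) → E p z ≡ true →
                ∃ λ c → E w c ≡ true × Σ (Path E c z) λ P′ →
                (∀ y → On y P′ → y ≡ z ⊎ On y P) × (c ≡ z → w ≡ p)
  uncons-snoc here e = _ , e , here , (λ y → inj₁) , λ _ → refl
  uncons-snoc (there {v = c} e′ P) e = c , e′ , P ++ edge e , on , λ { refl → contradiction P (acyclic _ _ e) }
    where
    on : ∀ y → On y (P ++ edge e) → _
    on y o with on-++ P (edge e) o
    ... | inj₁ oP          = inj₂ (inj₂ oP)
    ... | inj₂ (inj₁ refl) = inj₂ (inj₂ (on-end P))
    ... | inj₂ (inj₂ y≡z)  = inj₁ y≡z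

  -- Take root paths to both parents. The top of the cycle is the last vertex of the path to `q`
  -- that lies on the path to `p`.
  hybrid-gall : E p z ≡ true → E q z ≡ true → p ≢ q → ∃ λ w → Gall w z
  hybrid-gall {p} {z} {q} ep eq p≢q with lastHit (λ y → on? y (from-root p)) (from-root q)
  ... | inj₂ none = contradiction (on-start (from-root p)) (none ρ (on-start (from-root q)))
  ... | inj₁ (w , ow , _ , Q , only , _)
        with uncons-snoc (suffix (from-root p) ow) ep | uncons-snoc Q eq
  ...   | c , ec , P′ , onP , cz | d , ed , Q′ , onQ , dz = w , record
          { e₁ = ec ; e₂ = ed ; c₁≢c₂ = c≢d ; side₁ = P′ ; side₂ = Q′ ; meet = meet }
    where
    meet : ∀ y → On y P′ → On y Q′ → y ≡ z
    meet y o o′ with onP y o | onQ y o′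
    ... | inj₁ y≡z | _ = y≡z
    ... | _ | inj₁ y≡z = y≡z
    -- By the choice of `w` a common vertex other than `z` is `w` itself, which cannot lie below its
    -- own child `c`.
    ... | inj₂ oP | inj₂ oQ with only y oQ (suffix-⊆ (from-root p) ow oP)
    ...   | refl = contradiction o (top≢ ec P′)
    c≢d : c ≢ d
    c≢d refl with meet c (on-start P′) (on-start Q′)
    ... | c≡z = p≢q (trans (sym (cz c≡z)) (dz c≡z))

  module Around {v h : Fin k} (g : Gall v h) where
    open Gall g

    C : Fin k → Set
    C = Inside g

    C? : ∀ z → Dec (C z)
    C? = inside? g

    C-predecessor : C z → z ≢ v → ∃ λ q → E q z ≡ true × C q
    C-predecessor (inj₁ z≡v) z≢v = contradiction z≡v z≢v
    C-predecessor (inj₂ (inj₁ o)) z≢v with on-predecessor side₁ o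
    ... | inj₁ refl         = v , e₁ , inj₁ refl
    ... | inj₂ (q , e , oq) = q , e , inj₂ (inj₁ oq)
    C-predecessor (inj₂ (inj₂ o)) z≢v with on-predecessor side₂ o
    ... | inj₁ refl         = v , e₂ , inj₁ refl
    ... | inj₂ (q , e , oq) = q , e , inj₂ (inj₂ oq)

    C-from-v : C z → Path E v z
    C-from-v (inj₁ refl)     = here
    C-from-v (inj₂ (inj₁ o)) = there e₁ (prefix side₁ o)
    C-from-v (inj₂ (inj₂ o)) = there e₂ (prefix side₂ o)

    -- A second parent would give a gall sharing the edge above z with g.
    single-parent : C z → z ≢ v → z ≢ h → E p z ≡ true → E q z ≡ true → p ≡ q
    single-parent {z} {p} {q} Cz z≢v z≢h ep eq = decidable-stable (p ≟ q) λ p≢q →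
      contra (C-predecessor Cz z≢v) p≢q (hybrid-gall ep eq p≢q)
      where
      contra : (∃ λ y → E y z ≡ true × C y) → p ≢ q → (∃ λ w → Gall w z) → ⊥
      contra (y , ey , Cy) p≢q (w , g′) = z≢h (hybrid-unique E n4 {S = λ x → does (both? x)}
        (Biconnected-∪ (inside-biconnected g) (inside-biconnected g′) (edge-≢ ey)
          (does⁺ (C? y) Cy) (does⁺ (C? z) Cz)
          (does⁺ (inside? g′ y) (proj₂ (gall-hybrid g′) y ey)) (does⁺ (inside? g′ z) (inside-h g′))
          (λ x c → does⁺ (both? x) (inj₁ (does⁻ (C? x) c)))
          (λ x c → does⁺ (both? x) (inj₂ (does⁻ (inside? g′ x) c)))
          λ x b → Sum.map (does⁺ (C? x)) (does⁺ (inside? g′ x)) (does⁻ (both? x) b))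
        (gall-in g′ λ x → does⁺ (both? x) ∘ inj₂) (gall-in g λ x → does⁺ (both? x) ∘ inj₁))
        where
        both? : ∀ x → Dec (C x ⊎ Inside g′ x)
        both? x = C? x ⊎-dec inside? g′ x

    C-parents : C z → z ≢ v → E p z ≡ true → C p
    C-parents {z} {p} Cz z≢v ep with z ≟ h
    ... | yes refl = proj₂ (gall-hybrid g) p ep
    ... | no z≢h with C-predecessor Cz z≢v
    ...   | q , eq , Cq = subst C (single-parent Cz z≢v z≢h eq ep) Cq

    -- The first cycle vertex on the path has a parent off the cycle, which only `v` can have.
    entry : Path E w z → C z → ¬ C w → Path E w v
    entry here Cz ¬Cw = contradiction Cz ¬Cw
    entry (there {v = y} e P) Cz ¬Cw with C? y
    ... | no ¬Cy = there e (entry P Cz ¬Cy)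
    ... | yes Cy with y ≟ v
    ...   | yes refl = edge e
    ...   | no  y≢v  = contradiction (C-parents Cy y≢v e) ¬Cw

    -- A return to the cycle would enter through `v`, so `v` and `w` would lie below each other.
    below-v : Path E v w → ¬ C w → Path E w z → ¬ C z
    below-v P ¬Cw Q Cz with antisym P (entry Q Cz ¬Cw)
    ... | refl = ¬Cw (inj₁ refl)

    -- The exit point of some path; `hangs-unique` shows that it does not depend on the path.
    Hangs : Fin k → Fin k → Set
    Hangs u x = C u × Σ (Path E u x) λ P → ∀ z → On z P → C z → z ≡ u

    hangs-path : Hangs u x → Path E u x
    hangs-path = proj₁ ∘ proj₂

    -- Paths from two different exits meet first in some `y` off the cycle and form an ear. The
    -- cycle with this ear is biconnected and contains the hybrids `y` and `h` with all their
    -- parents, so `y` would be `h`.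
    hangs-unique : Hangs u x → Hangs w x → u ≡ w
    hangs-unique {u} {x} {w} (Cu , P , onlyP) (Cw , Q , onlyQ) = decidable-stable (u ≟ w) contra
      where
      contra : u ≢ w → ⊥
      contra u≢w with firstHit (λ z → on? z P) Q (on-end P)
      ... | y , oy , Q₁ , only , Q₁⊆Q = ¬Cy (subst C (sym y≡h) (inside-h g))
        where
        P₁ : Path E u y
        P₁ = prefix P oy
        meetPQ : ∀ z → On z P₁ → On z Q₁ → z ≡ y
        meetPQ z o o′ = only z o′ (prefix-⊆ P oy o)
        ¬Cy : ¬ C y
        ¬Cy Cy = u≢w (trans (sym (onlyP y oy Cy)) (onlyQ y (Q₁⊆Q y (on-end Q₁)) Cy))
        y≢ : ∀ {c} → C c → y ≢ c
        y≢ Cc refl = ¬Cy Cc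
        T? : ∀ z → Dec (C z ⊎ On z P₁ ⊎ On z Q₁)
        T? z = C? z ⊎-dec (on? z P₁ ⊎-dec on? z Q₁)
        T : Fin k → Bool
        T z = does (T? z)
        bT : Biconnected E T
        bT = ear (inside-biconnected g) (does⁺ (C? u) Cu) (does⁺ (C? w) Cw) u≢w P₁ Q₁ meetPQ
               (λ z c → does⁺ (T? z) (inj₁ (does⁻ (C? z) c)))
               (λ z o → does⁺ (T? z) (inj₂ (inj₁ o)))
               (λ z o → does⁺ (T? z) (inj₂ (inj₂ o)))
               (λ z t → Sum.map₁ (does⁺ (C? z)) (does⁻ (T? z) t))
        y≡h : y ≡ h
        y≡h with on-predecessor P₁ (on-end P₁) | on-predecessor Q₁ (on-end Q₁)
        ... | inj₁ y≡u | _ = contradiction y≡u (y≢ Cu)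
        ... | _ | inj₁ y≡w = contradiction y≡w (y≢ Cw)
        ... | inj₂ (p , ep , op) | inj₂ (q , eq , oq) = hybrid-unique E n4 bT
              (two-parents ep eq p≢q , does⁺ (T? y) (inj₂ (inj₁ (on-end P₁))) , parents)
              (gall-in g λ z → does⁺ (T? z) ∘ inj₁)
          where
          p≢q : p ≢ q
          p≢q refl = edge-≢ ep (meetPQ p op oq)
          parents : ∀ z → E z y ≡ true → T z ≡ true
          parents z ez with only-parents ep eq p≢q ez
          ... | inj₁ refl = does⁺ (T? z) (inj₂ (inj₁ op))
          ... | inj₂ refl = does⁺ (T? z) (inj₂ (inj₂ oq))

    hang : C w → Path E w x → ∃ λ u → Hangs u x × Path E w u
    hang Cw P with lastHit C? P
    ... | inj₁ (u , Cu , P₁ , P₂ , only , _) = u , (Cu , P₂ , only) , P₁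
    ... | inj₂ none = contradiction Cw (none _ (on-start P))

    reaches-hang : C w → Path E w x → Hangs u x → Path E w u
    reaches-hang Cw P hu with hang Cw P
    ... | u′ , hu′ , P₁ = subst (Path E _) (hangs-unique hu′ hu) P₁

    -- If `w` is off the cycle, a path from `v` to `w` leaves the cycle in some `c`, and everything
    -- below `w` hangs from this `c`.
    common-inside : Path E v w → Path E w x → Path E w y → Hangs u x → Hangs z y → u ≢ z → C w
    common-inside {w} {x} {y} P Px Py hu hz u≢z = decidable-stable (C? w) λ ¬Cw → contra ¬Cw (lastHit C? P)
      where
      contra : ¬ C w → _ → ⊥
      contra ¬Cw (inj₂ none) = none v (on-start P) (inj₁ refl)
      contra ¬Cw (inj₁ (c , Cc , _ , Q , only , _)) =
        u≢z (trans (hangs-unique hu (through Px)) (hangs-unique (through Py) hz))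
        where
        through : ∀ {x} → Path E w x → Hangs c x
        through R = Cc , Q ++ R , λ z o Cz → [ (λ oQ → only z oQ Cz)
          , (λ oR → contradiction Cz (below-v P ¬Cw (prefix R oR))) ]′ (on-++ Q R o)

    -- An edge from `side₁` to a vertex of `side₂` before `h` would give that vertex a second
    -- parent. A detour off the cycle is impossible, as it would have to return.
    no-crossing : On w side₁ → Path E w z → On z side₂ → z ≡ h
    no-crossing ow here oz = meet _ ow oz
    no-crossing {w} ow (there {v = y} e P) oz with w ≟ h
    ... | yes refl = antisym (suffix side₂ oz) (there e P)
    ... | no w≢h with C? y
    ...   | no ¬Cy = contradiction (inj₂ (inj₂ oz)) (below-v (there e₁ (prefix side₁ ow) ++ edge e) ¬Cy P)
    ...   | yes (inj₁ refl) = contradiction (there e₁ (prefix side₁ ow)) (acyclic _ _ e)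
    ...   | yes (inj₂ (inj₁ oy)) = no-crossing oy P oz
    ...   | yes Cy@(inj₂ (inj₂ oy)) with y ≟ h
    ...     | yes refl = antisym (suffix side₂ oz) P
    ...     | no y≢h with on-predecessor side₂ oy
    ...       | inj₁ refl = contradiction
                  (subst (λ z → On z side₁) (single-parent Cy (edge-≢ e₂ ∘ sym) y≢h e e₂) ow) (top≢ e₁ side₁)
    ...       | inj₂ (q , eq , oq) = contradiction
                  (meet w ow (subst (λ z → On z side₂) (single-parent Cy (λ { refl → top≢ e₂ side₂ oy }) y≢h eq e) oq)) w≢h

-- Primitive graphs explained by a network

module _ {m : ℕ} (H : Graph m) (prim : Primitive H) where

  primitive-module : ∀ {M} → IsModule H M → ∀ {a b} z → M a ≡ true → M b ≡ true → M z ≡ false → a ≡ b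
  primitive-module {M} mod z Ma Mb Mz with proj₂ prim M mod
  ... | inj₁ ≤1  = count≤1⁻ ≤1 Ma Mb
  ... | inj₂ all = contradiction (trans (sym (all z)) Mz) true≢false

  -- `A` and its complement are both modules and neither is everything, so together they have at
  -- most two vertices, against the four of a primitive graph.
  primitive-unsplit : ∀ (A : Fin m → Bool) i j {β} → A i ≡ true → A j ≡ false →
                      (∀ a b → A a ≡ true → A b ≡ false → adj H a b ≡ β) → ⊥
  primitive-unsplit A i j Ai Aj cross with proj₂ prim A inA | proj₂ prim (not ∘ A) outA
    where
    inA : IsModule H A
    inA x y z Ax Ay Az = trans (cross x z Ax Az) (sym (cross y z Ay Az))
    unnot : ∀ {b c} → not b ≡ c → b ≡ not c
    unnot {true}  refl = refl
    unnot {false} refl = refl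
    outA : IsModule H (not ∘ A)
    outA x y z Ax Ay Az = trans (trans (adj-sym H x z) (cross z x (unnot Az) (unnot Ax)))
      (sym (trans (adj-sym H y z) (cross z y (unnot Az) (unnot Ay))))
  ... | inj₂ all | _ = true≢false (trans (sym (all j)) Aj)
  ... | _ | inj₂ all = true≢false (trans (sym (all i)) (cong not Ai))
  ... | inj₁ c | inj₁ c′ with ℕ.≤-trans (proj₁ prim) (subst (_≤ 2) (count-compl A) (ℕ.+-mono-≤ c c′))
  ...   | s≤s (s≤s ())

-- Every vertex of a P4 has both a neighbour and a non-neighbour among the other three.
dominated⇒¬P4 : ∀ {m} (H : Graph m) (f : Fin 4 → Fin m) → ∀ a {β} →
                (∀ b → b ≢ a → adj H (f a) (f b) ≡ β) → ¬ InducedP4 H f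
dominated⇒¬P4 H f zero dom (e01 , e12 , e23 , n02 , n03 , n13) =
  true≢false (trans (sym e01) (trans (trans (dom (suc zero) λ ()) (sym (dom (suc (suc zero)) λ ()))) n02))
dominated⇒¬P4 H f (suc zero) dom (e01 , e12 , e23 , n02 , n03 , n13) =
  true≢false (trans (sym e12) (trans (trans (dom (suc (suc zero)) λ ()) (sym (dom (suc (suc (suc zero))) λ ()))) n13))
dominated⇒¬P4 H f (suc (suc zero)) dom (e01 , e12 , e23 , n02 , n03 , n13) =
  true≢false (trans (sym e23) (trans (trans (dom (suc (suc (suc zero))) λ ()) (sym (dom zero λ ())))
    (trans (adj-sym H _ _) n02)))
dominated⇒¬P4 H f (suc (suc (suc zero))) dom (e01 , e12 , e23 , n02 , n03 , n13) =
  true≢false (trans (sym e23) (trans (adj-sym H _ _)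
    (trans (trans (dom (suc (suc zero)) λ ()) (sym (dom zero λ ()))) (trans (adj-sym H _ _) n03))))

module Explained {k : ℕ} (E : DEdges k) (acyclic : Acyclic E)
  (ρ : Fin k) (from-root : ∀ v → Path E ρ v)
  (two-parents : ∀ {p q z} → E p z ≡ true → E q z ≡ true → p ≢ q → indeg E z ≡ 2)
  (n4 : AtMostOneHybrid E)
  {r : ℕ} (H : Graph (suc (suc r))) (prim : Primitive H)
  (x : Fin (suc (suc r)) → Fin k) (x-sink : ∀ i w → E (x i) w ≢ true) (x-injective : Injective _≡_ _≡_ x)
  (val : Fin k → Bool)
  (explains : ∀ i j → i ≢ j → ∀ w → IsLCA E (x i) (x j) w → adj H i j ≡ val w) where

  open Dag E acyclic
  open GalledNetwork E acyclic ρ from-root two-parents n4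

  m : ℕ
  m = suc (suc r)

  other : (a : Fin m) → ∃ λ b → b ≢ a
  other zero    = suc zero , λ ()
  other (suc a) = zero , λ ()

  lca-below : ∀ {a b} w → Path E w a → Path E w b → ∃ λ u → Path E w u × IsLCA E a b u
  lca-below {a} {b} w = go w (⊏-noetherian w)
    where
    go : ∀ w → Acc (flip _⊏_) w → Path E w a → Path E w b → ∃ λ u → Path E w u × IsLCA E a b u
    go w (acc rs) Pa Pb with Fin.any? (λ c → (E w c Bool.≟ true) ×-dec (path? c a ×-dec path? c b))
    ... | yes (c , e , Qa , Qb) with go c (rs (c , e , here)) Qa Qb
    ...   | u , P , lca = u , there e P , lca
    go w _ Pa Pb | no none = w , here , Pa , Pb , λ
      { w′ _  _  here        → refl
      ; w′ Qa Qb (there e P) → contradiction (_ , e , P ++ Qa , P ++ Qb) none }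

  ReachesAll : Fin k → Set
  ReachesAll v = ∀ i → Path E v (x i)

  lowest : ∃ λ v → ReachesAll v × (∀ c → E v c ≡ true → ¬ ReachesAll c)
  lowest = go ρ (⊏-noetherian ρ) (λ i → from-root (x i))
    where
    go : ∀ v → Acc (flip _⊏_) v → ReachesAll v → _
    go v (acc rs) all with Fin.any? (λ c → (E v c Bool.≟ true) ×-dec Fin.all? (λ i → path? c (x i)))
    ... | yes (c , e , all′) = go c (rs (c , e , here)) all′
    ... | no none = v , all , λ c e all′ → none (c , e , all′)

  no-child⇒lca : ∀ {v i j} → ReachesAll v →
                 (∀ c → E v c ≡ true → Path E c (x i) → ¬ Path E c (x j)) → IsLCA E (x i) (x j) v
  no-child⇒lca {v} {i} {j} all none = all i , all j , λ
    { w′ _ _ here → refl ; w′ Pi Pj (there e P) → contradiction (P ++ Pj) (none _ e (P ++ Pi)) }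

  -- `first` supplies a leaf that hangs strictly below `v`, without which `v` could carry all
  -- leaves.
  module AtGall {v h} (g : Gall v h) (all : ReachesAll v)
    (low : ∀ c → E v c ≡ true → ¬ ReachesAll c)
    {i₀ : Fin m} (first : Path E (Gall.c₁ g) (x i₀))
    (pos : Fin m → Fin k) (hangs : ∀ i → Around.Hangs g (pos i) (x i)) where

    open Gall g
    open Around g

    pos-C : ∀ i → C (pos i)
    pos-C i = proj₁ (hangs i)

    pos-path : ∀ i → Path E (pos i) (x i)
    pos-path i = hangs-path (hangs i)

    from-v : ∀ i → Path E v (pos i)
    from-v i = C-from-v (pos-C i)

    common-C : ∀ {i j w} → pos i ≢ pos j → Path E v w → Path E w (x i) → Path E w (x j) → C w
    common-C {i} {j} i≢j P Pi Pj = common-inside P Pi Pj (hangs i) (hangs j) i≢j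

    -- `pos i` is the least common ancestor: one below it would lie on the cycle and therefore still
    -- reach `pos i`. The label of `pos i` thus decides all adjacencies of `i` to leaves further
    -- down.
    adj-above : ∀ {i j} → pos i ≢ pos j → Path E (pos i) (pos j) → adj H i j ≡ val (pos i)
    adj-above {i} {j} i≢j P = explains i j (i≢j ∘ cong pos) (pos i)
      (pos-path i , P ++ pos-path j , λ w′ Pi Pj Q →
        antisym (reaches-hang (common-C i≢j (from-v i ++ Q) Pi Pj) Pi (hangs i)) Q)

    -- Common ancestors of leaves with different positions lie on the cycle, and a cycle vertex is
    -- above a leaf exactly if it is above its position. So `i` and `j` have the same least common
    -- ancestors with `l`.
    same-pos : ∀ {i j l} → pos i ≡ pos j → pos l ≢ pos i → adj H i l ≡ adj H j l
    same-pos {i} {j} {l} i≡j l≢i with lca-below v (all i) (all l)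
    ... | w , Pw , Pi , Pl , least =
          trans (explains i l (l≢i ∘ sym ∘ cong pos) w (Pi , Pl , least))
            (sym (explains j l (λ { refl → l≢i (sym i≡j) }) w (Pj , Pl , least′)))
      where
      move : ∀ {a b w} → C w → pos a ≡ pos b → Path E w (x a) → Path E w (x b)
      move {a} {b} Cw a≡b P = subst (Path E _) a≡b (reaches-hang Cw P (hangs a)) ++ pos-path b
      Pj : Path E w (x j)
      Pj = move (common-C (l≢i ∘ sym) Pw Pi Pl) i≡j Pi
      least′ : ∀ w′ → Path E w′ (x j) → Path E w′ (x l) → Path E w w′ → w′ ≡ w
      least′ w′ Qj Ql Q = least w′ (move (common-C (λ j≡l → l≢i (trans (sym j≡l) (sym i≡j))) (Pw ++ Q) Qj Ql) (sym i≡j) Qj) Ql Q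

    -- The leaves at `v` see all others through the label of `v`, which would be a uniform
    -- bipartition; `i₀` is on the other side.
    pos≢v : ∀ i → pos i ≢ v
    pos≢v i pi≡v = primitive-unsplit H prim (λ a → does (pos a ≟ v)) i i₀
      (does⁺ (pos i ≟ v) pi≡v) (does-false⁺ (pos i₀ ≟ v) p₀≢v)
      λ a b Aa Ab → let pa≡v = does⁻ (pos a ≟ v) Aa ; pb≢v = does-false⁻ (pos b ≟ v) Ab in
        trans (adj-above (λ e → pb≢v (trans (sym e) pa≡v)) (subst (λ u → Path E u (pos b)) (sym pa≡v) (from-v b)))
              (cong val pa≡v)
      where
      p₀≢v : pos i₀ ≢ v
      p₀≢v p₀≡v = acyclic _ _ e₁ (subst (Path E c₁) p₀≡v
        (reaches-hang (inj₂ (inj₁ (on-start side₁))) first (hangs i₀)))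

    pos-injective : ∀ {i j} → pos i ≡ pos j → i ≡ j
    pos-injective {i} {j} i≡j with Fin.any? (λ l → ¬? (pos l ≟ pos i))
    ... | yes (l , l≢i) = primitive-module H prim
          {M = λ a → does (pos a ≟ pos i)}
          (λ a b c Ma Mb Mc → let a≡i = does⁻ (pos a ≟ pos i) Ma in
             same-pos (trans a≡i (sym (does⁻ (pos b ≟ pos i) Mb)))
               λ c≡a → does-false⁻ (pos c ≟ pos i) Mc (trans c≡a a≡i))
          l
          (does⁺ (pos i ≟ pos i) refl) (does⁺ (pos j ≟ pos i) (sym i≡j)) (does-false⁺ (pos l ≟ pos i) l≢i)
    -- All leaves would hang from one vertex below `v`, and the child of `v` towards it would reach
    -- them all, against `low`.
    ... | no none = contradiction (from-v i) (no-path (pos≢v i ∘ sym))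
      where
      at-i : ∀ l → pos l ≡ pos i
      at-i l = decidable-stable (pos l ≟ pos i) λ l≢i → none (l , l≢i)
      no-path : v ≢ pos i → ¬ Path E v (pos i)
      no-path v≢ P = go P refl
        where
        go : ∀ {u} → Path E v u → u ≢ pos i
        go here        refl = v≢ refl
        go (there e P) refl = low _ e λ l → P ++ subst (λ u → Path E u (x l)) (at-i l) (pos-path l)

    topmost : ∀ {c q} (S : Path E c h) (f : Fin (suc q) → Fin m) → (∀ a → On (pos (f a)) S) →
              ∃ λ a → ∀ b → Path E (pos (f a)) (pos (f b))
    topmost {q = zero}  S f on = zero , λ { zero → here }
    topmost {q = suc q} S f on with topmost S (f ∘ suc) (on ∘ suc)
    ... | a , top with on-comparable S (on zero) (on (suc a))
    ...   | inj₁ P = zero , λ { zero → here ; (suc b) → P ++ top b }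
    ...   | inj₂ P = suc a , λ { zero → P ; (suc b) → top b }

    -- Otherwise the topmost leaf would be uniform to all others and could be split off.
    not-one-sided : ∀ {c} (S : Path E c h) → ¬ (∀ i → On (pos i) S)
    not-one-sided S on with topmost S id on
    ... | a , top = primitive-unsplit H prim (λ i → does (i ≟ a)) a (proj₁ (other a))
          (does⁺ (a ≟ a) refl) (does-false⁺ (proj₁ (other a) ≟ a) (proj₂ (other a)))
          cross
      where
      cross : ∀ i j → does (i ≟ a) ≡ true → does (j ≟ a) ≡ false → adj H i j ≡ val (pos a)
      cross i j i≡a j≢a with refl ← does⁻ (i ≟ a) i≡a =
        adj-above (λ e → does-false⁻ (j ≟ a) j≢a (sym (pos-injective e))) (top j)

    module Side {c} (S : Path E c h) where

      mem : Fin m → Bool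
      mem i = does (on? (pos i) S)

      f : Fin (count mem) → Fin m
      f = enum mem

      f-on : ∀ a → On (pos (f a)) S
      f-on a = does⁻ (on? _ S) (enum-sound mem a)

      image⁻ : ∀ {i} → InImage f i → On (pos i) S
      image⁻ (a , refl) = f-on a

      image⁺ : ∀ {i} → On (pos i) S → InImage f i
      image⁺ {i} o = enum-complete mem i (does⁺ (on? (pos i) S) o)

      cograph : Cograph (induced H f)
      cograph p p-inj with topmost S (f ∘ p) (λ a → f-on (p a))
      ... | a , top = dominated⇒¬P4 (induced H f) p a λ b b≢a →
            adj-above (λ e → b≢a (sym (p-inj (enum-injective mem (pos-injective e))))) (top b)

      off : ∃ λ i → ¬ On (pos i) S
      off = Fin.¬∀⟶∃¬ m _ (λ i → on? (pos i) S) (not-one-sided S)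

    module S₁ = Side side₁
    module S₂ = Side side₂

    on-side : ∀ i → On (pos i) side₁ ⊎ On (pos i) side₂
    on-side i with pos-C i
    ... | inj₁ i≡v = contradiction i≡v (pos≢v i)
    ... | inj₂ o   = o

    -- A common ancestor on the cycle strictly below `v` lies on one side and would reach a vertex
    -- of the other side before `h`.
    cross : ∀ {i j} → On (pos i) side₁ → pos i ≢ h → On (pos j) side₂ → pos j ≢ h → adj H i j ≡ val v
    cross {i} {j} oi i≢h oj j≢h = explains i j (i≢j ∘ cong pos) v (all i , all j , least)
      where
      i≢j : pos i ≢ pos j
      i≢j e = i≢h (meet _ oi (subst (λ z → On z side₂) (sym e) oj))
      least : ∀ w′ → Path E w′ (x i) → Path E w′ (x j) → Path E v w′ → w′ ≡ v
      least w′ Pi Pj Q with common-C i≢j Q Pi Pj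
      ... | inj₁ refl = refl
      ... | Cw@(inj₂ (inj₁ o)) = contradiction (no-crossing o (reaches-hang Cw Pj (hangs j)) oj) j≢h
      ... | Cw@(inj₂ (inj₂ o)) = contradiction
              (Around.no-crossing (swap g) o (reaches-hang Cw Pi (hangs i)) oi) i≢h

    -- With no leaf at the hybrid, the label of `v` would decide all adjacencies between the sides
    -- and split `H`. The leaf found here is the common vertex of the two cographs.
    ∃-at-h : ∃ λ i → pos i ≡ h
    ∃-at-h with Fin.any? (λ i → pos i ≟ h)
    ... | yes found = found
    ... | no none = ⊥-elim (primitive-unsplit H prim S₁.mem (proj₁ S₂.off) (proj₁ S₁.off)
          (does⁺ (on? _ side₁) (Sum.fromInj₁ (λ o → contradiction o (proj₂ S₂.off)) (on-side (proj₁ S₂.off))))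
          (does-false⁺ (on? _ side₁) (proj₂ S₁.off))
          λ i j i∈ j∉ → cross (does⁻ (on? _ side₁) i∈) (λ e → none (i , e))
            (Sum.fromInj₂ (λ o → contradiction o (does-false⁻ (on? _ side₁) j∉)) (on-side j)) (λ e → none (j , e)))

    pseudo : PseudoCograph H
    pseudo = inj₂ (count S₁.mem , (S₁.f , enum-injective S₁.mem) , count S₂.mem , (S₂.f , enum-injective S₂.mem) , i
      , (λ j → Sum.map S₁.image⁺ S₂.image⁺ (on-side j))
      , S₁.image⁺ oi₁ , S₂.image⁺ oi₂
      , (λ j j₁ j₂ → at-h (meet _ (S₁.image⁻ j₁) (S₂.image⁻ j₂)))
      , 2≤count {p = S₁.mem} (does⁺ (on? _ side₁) oi₁) (does⁺ (on? _ side₁) (Sum.fromInj₁ (λ o → contradiction o (proj₂ S₂.off)) (on-side (proj₁ S₂.off))))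
          (λ e → proj₂ S₂.off (subst (λ a → On (pos a) side₂) e oi₂))
      , 2≤count {p = S₂.mem} (does⁺ (on? _ side₂) oi₂) (does⁺ (on? _ side₂) (Sum.fromInj₂ (λ o → contradiction o (proj₂ S₁.off)) (on-side (proj₁ S₁.off))))
          (λ e → proj₂ S₁.off (subst (λ a → On (pos a) side₁) e oi₁))
      , S₁.cograph , S₂.cograph
      , Sum.map uniform uniform (dec-bool (val v)))
      where
      i : Fin m
      i = proj₁ ∃-at-h
      at-h : ∀ {j} → pos j ≡ h → j ≡ i
      at-h e = pos-injective (trans e (sym (proj₂ ∃-at-h)))
      oi₁ : On (pos i) side₁
      oi₁ = subst (λ z → On z side₁) (sym (proj₂ ∃-at-h)) (on-end side₁)
      oi₂ : On (pos i) side₂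
      oi₂ = subst (λ z → On z side₂) (sym (proj₂ ∃-at-h)) (on-end side₂)
      uniform : ∀ {β} → val v ≡ β → ∀ a b → InImage S₁.f a → a ≢ i → InImage S₂.f b → b ≢ i → adj H a b ≡ β
      uniform vβ a b a₁ a≢i b₂ b≢i = trans (cross (S₁.image⁻ a₁) (a≢i ∘ at-h) (S₂.image⁻ b₂) (b≢i ∘ at-h)) vβ

  pseudoCograph : PseudoCograph H
  pseudoCograph with lowest
  ... | v , all , low = go (all zero) (all (suc zero))
    where
    module _ {c} (e : E v c ≡ true) (P : Path E c (x zero)) where
      missed : ∃ λ j → ¬ Path E c (x j)
      missed = Fin.¬∀⟶∃¬ m _ (λ j → path? c (x j)) (low c e)

      -- A child `d` sharing a leaf with `c` and reaching one that `c` misses differs from `c`, so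
      -- the two close a cycle. If there is none, `v` is a least common ancestor of each leaf below
      -- `c` with each other leaf, and `H` splits.
      Overlap : Fin k → Fin m → Fin m → Set
      Overlap d i j = E v d ≡ true × (Path E c (x i) × ¬ Path E c (x j)) × Path E d (x i) × Path E d (x j)

      overlap? : Dec (∃ λ d → ∃ λ i → ∃ λ j → Overlap d i j)
      overlap? = Fin.any? λ d → Fin.any? λ i → Fin.any? λ j →
        (E v d Bool.≟ true) ×-dec ((path? c (x i) ×-dec ¬? (path? c (x j))) ×-dec (path? d (x i) ×-dec path? d (x j)))

      overlapping : (∃ λ d → ∃ λ i → ∃ λ j → Overlap d i j) → PseudoCograph H
      overlapping (d , i , j , e′ , (Pi , ¬Pj) , Qi , Qj)
        with first-meeting e e′ (λ { refl → ¬Pj Qj }) Pi Qi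
      ... | h , g , c₁≡c = AtGall.pseudo g all low (subst (λ c → Path E c (x i)) (sym c₁≡c) Pi)
              (λ i → proj₁ (Around.hang g (inj₁ refl) (all i)))
              (λ i → proj₁ (proj₂ (Around.hang g (inj₁ refl) (all i))))

      separate : ¬ (∃ λ d → ∃ λ i → ∃ λ j → Overlap d i j) → ⊥
      separate none = primitive-unsplit H prim (λ i → does (path? c (x i))) zero (proj₁ missed)
        (does⁺ (path? c (x zero)) P) (does-false⁺ (path? c (x (proj₁ missed))) (proj₂ missed))
        λ a b Aa Ab → let Pa = does⁻ (path? c (x a)) Aa ; ¬Pb = does-false⁻ (path? c (x b)) Ab in
          explains a b (λ { refl → ¬Pb Pa }) v
            (no-child⇒lca all λ d e′ Qa Qb → none (d , a , b , e′ , (Pa , ¬Pb) , Qa , Qb))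

    go : Path E v (x zero) → Path E v (x (suc zero)) → PseudoCograph H
    go P Q = step P Q refl refl
      where
      -- The end points are generalised for the sake of matching. The vertex `v` has a child above
      -- `x zero`, since a sink equal to `x zero` could not reach a second leaf.
      step : ∀ {a b} → Path E v a → Path E v b → a ≡ x zero → b ≡ x (suc zero) → PseudoCograph H
      step here here p q = contradiction (x-injective (trans (sym p) q)) λ ()
      step here (there e _) refl _ = contradiction e (x-sink zero _)
      step (there e P) _ refl _ with overlap? e P
      ... | yes found = overlapping e P found
      ... | no none   = ⊥-elim (separate e P none)

-- From galled-trees to pseudo-cographs

is-l1 : Label → Bool
is-l1 l0 = false
is-l1 l1 = true
is-l1 l⊙ = false

is-l1⁻ : ∀ l → is-l1 l ≡ true → l ≡ l1
is-l1⁻ l1 _ = refl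

GaTEx⇒pseudoCographs : ∀ {n} (G : Graph n) → GaTEx G → ∀ m (f : Embedding m n) →
                       Primitive (induced G (proj₁ f)) → PseudoCograph (induced G (proj₁ f))
GaTEx⇒pseudoCographs G (k , E , ℓ , t , (_ , _ , _ , inj₁ (refl , _)) , _) _ (f , f-inj) (s≤s (s≤s _) , _) =
  contradiction (f-inj {zero} {suc zero} (only (f zero) (f (suc zero)))) λ ()
  where
  only : (a b : Fin 1) → a ≡ b
  only zero zero = refl
GaTEx⇒pseudoCographs G (k , E , ℓ , t ,
  (ℓ-inj , _ , acyclic , inj₂ ((ρ , ρ-top , _ , ρ-unique , kinds) , leaves , n4)) , _ , explains)
  (suc (suc _)) (f , f-inj) prim =
  Explained.pseudoCograph E acyclic ρ (λ v → from-root v (⊏-wellFounded v)) two-parents n4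
    (induced G f) prim (ℓ ∘ f) sink (f-inj ∘ ℓ-inj) (is-l1 ∘ t)
    λ i j i≢j w lca → let open Equivalence (explains (f i) (f j) (i≢j ∘ f-inj) w lca) in
      ⇔true⇒≡ (λ a → cong is-l1 (to a)) (λ l → from (is-l1⁻ (t w) l))
  where
  open Dag E acyclic

  from-root : ∀ v → Acc _⊏_ v → Path E ρ v
  from-root v (acc rs) with Fin.any? (λ u → E u v Bool.≟ true)
  ... | yes (u , e) = from-root u (rs (v , e , here)) ++ edge e
  ... | no none = subst (Path E ρ) (sym (ρ-unique v (count-none λ u → ¬true⇒false λ e → none (u , e)))) here

  two-parents : ∀ {p q z} → E p z ≡ true → E q z ≡ true → p ≢ q → indeg E z ≡ 2
  two-parents {p} {q} {z} ep eq p≢q = cases (Fin.any? (λ i → ℓ i ≟ z)) (z ≟ ρ)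
    where
    not-one : indeg E z ≢ 1
    not-one ≡1 = p≢q (count≤1⁻ (ℕ.≤-reflexive ≡1) ep eq)
    cases : Dec (InImage ℓ z) → Dec (z ≡ ρ) → indeg E z ≡ 2
    cases (yes leaf) _          = contradiction (proj₂ (Equivalence.to (leaves z) leaf)) not-one
    cases (no _)     (yes refl) = contradiction ep (count≡0⁻ {p = λ u → E u ρ} {a = p} ρ-top)
    cases (no ¬leaf) (no z≢ρ)   = [ (λ (≡1 , _) → contradiction ≡1 not-one) , proj₁ ]′ (kinds z ¬leaf z≢ρ)

  sink : ∀ i w → E (ℓ (f i)) w ≢ true
  sink i w = count≡0⁻ {p = E (ℓ (f i))} {a = w} (proj₁ (Equivalence.to (leaves (ℓ (f i))) (f i , refl)))
GaTEx⇒pseudoCographs G _ (suc zero) _ (s≤s () , _)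

-- Rooted networks

-- The root is nothing, the other vertices form W.
Edges : Set → Set₁
Edges W = Maybe W → W → Set

data Reach {W : Set} (E : Edges W) : Maybe W → Maybe W → Set where
  here  : ∀ {v} → Reach E v v
  there : ∀ {v w y} → E v w → Reach E (just w) y → Reach E v y

infixr 5 _++ʳ_
_++ʳ_ : ∀ {W} {E : Edges W} {u v w} → Reach E u v → Reach E v w → Reach E u w
here      ++ʳ q = q
there e p ++ʳ q = there e (p ++ʳ q)

module _ {W : Set} (E : Edges W) where

  -- Degrees are given by witnesses, which pass through gluing directly; they become counts only
  -- when the finished network is numbered.
  OneParent TwoParents : W → Set
  OneParent w = ∃ λ u → E u w × (∀ y → E y w → y ≡ u)
  TwoParents w = ∃ λ u → ∃ λ v → u ≢ v × E u w × E v w × (∀ y → E y w → y ≡ u ⊎ y ≡ v)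

  OneChild TwoChildren Childless : Maybe W → Set
  OneChild v = ∃ (E v)
  TwoChildren v = ∃ λ w → ∃ λ y → w ≢ y × E v w × E v y
  Childless v = ∀ w → ¬ E v w

  MinimalCommonAncestor : Maybe W → Maybe W → Maybe W → Set
  MinimalCommonAncestor x y v = Reach E v x × Reach E v y ×
    (∀ u → Reach E u x → Reach E u y → Reach E v u → u ≡ v)

  -- A cut vertex between two hybrids, which rules out a common biconnected
  -- component and, unlike (N4), survives gluing networks without any transport of walks.
  Separated : W → W → Set
  Separated h h′ = ∃ λ c → ∃ λ (side : Maybe W → Bool) →
    c ≢ just h × c ≢ just h′ × side (just h) ≡ true × side (just h′) ≡ false ×
    (∀ u w → u ≢ c → just w ≢ c → E u w → side u ≡ side (just w))

  childless-reach : ∀ {v w} → Childless v → Reach E v w → w ≡ v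
  childless-reach none here        = refl
  childless-reach none (there e _) = contradiction e (none _)

-- A network for the subgraph induced on `X`. Vertices keep their names in `Fin n` and `ℓ` is
-- constrained on `X` only, so gluing involves no renumbering. Labels are Boolean; leaves receive
-- `l⊙` in the final galled-tree.
record Net {n : ℕ} (G : Graph n) (X : Fin n → Bool) : Set₁ where
  field
    W      : Set
    size   : ℕ
    finite : W ↔ Fin size
    E      : Edges W
    E?     : ∀ v w → Dec (E v w)
    ℓ      : Fin n → W
    label  : Maybe W → Bool
    acyclic    : ∀ {v w} → E v w → ¬ Reach E (just w) v
    root-out   : TwoChildren E nothing
    kind       : ∀ w → (∃ λ x → X x ≡ true × ℓ x ≡ w)
                     ⊎ (OneParent E w × TwoChildren E (just w))
                     ⊎ (TwoParents E w × OneChild E (just w))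
    leaf       : ∀ x → X x ≡ true → OneParent E (ℓ x) × Childless E (just (ℓ x))
    ℓ-injective : ∀ {x y} → X x ≡ true → X y ≡ true → ℓ x ≡ ℓ y → x ≡ y
    separated  : ∀ h h′ → TwoParents E h → TwoParents E h′ → h ≢ h′ → Separated E h h′
    explains   : ∀ x y → X x ≡ true → X y ≡ true → x ≢ y →
                 ∀ v → MinimalCommonAncestor E (just (ℓ x)) (just (ℓ y)) v → adj G x y ≡ label v

  _≟ᵂ_ : DecidableEquality W
  _≟ᵂ_ = via-injection (↔⇒↣ finite) _≟_

-- Gluing the root of a network N₂ on the leaves in M to the leaf m₀ of N₁.
module Substitution {n} (G : Graph n) (X X₁ M : Fin n → Bool) (m₀ : Fin n)
  (m₀∈M : M m₀ ≡ true) (m₀∈X₁ : X₁ m₀ ≡ true) (M⊆X : M ⊆B X)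
  (X₁⁻ : ∀ x → X₁ x ≡ true → x ≢ m₀ → X x ≡ true × M x ≡ false)
  (X₁⁺ : ∀ x → X x ≡ true → M x ≡ false → X₁ x ≡ true)
  (module-M : ∀ x y z → M x ≡ true → M y ≡ true → X z ≡ true → M z ≡ false → adj G x z ≡ adj G y z)
  (N₁ : Net G X₁) (N₂ : Net G M) where

  private
    module N₁ = Net N₁
    module N₂ = Net N₂

  W : Set
  W = N₁.W ⊎ N₂.W

  c : N₁.W
  c = N₁.ℓ m₀

  c-childless : Childless N₁.E (just c)
  c-childless = proj₂ (N₁.leaf m₀ m₀∈X₁)

  in₁ : Maybe N₁.W → Maybe W
  in₁ (just w) = just (inj₁ w)
  in₁ nothing  = nothing

  in₂ : Maybe N₂.W → Maybe W
  in₂ (just w) = just (inj₂ w)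
  in₂ nothing  = just (inj₁ c)

  in₁-injective : ∀ {u v} → in₁ u ≡ in₁ v → u ≡ v
  in₁-injective {nothing} {nothing} _    = refl
  in₁-injective {just _}  {just _}  refl = refl

  in₂-injective : ∀ {u v} → in₂ u ≡ in₂ v → u ≡ v
  in₂-injective {nothing} {nothing} _    = refl
  in₂-injective {just _}  {just _}  refl = refl

  in₁≢inj₂ : ∀ u {w} → in₁ u ≢ just (inj₂ w)
  in₁≢inj₂ nothing  ()
  in₁≢inj₂ (just _) ()

  in-overlap : ∀ u v → in₁ u ≡ in₂ v → u ≡ just c × v ≡ nothing
  in-overlap (just _) nothing refl = refl , refl
  in-overlap nothing  nothing  ()
  in-overlap nothing  (just _) ()
  in-overlap (just _) (just _) ()

  E : Edges W
  E v (inj₁ w) = ∃ λ u → v ≡ in₁ u × N₁.E u w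
  E v (inj₂ w) = ∃ λ u → v ≡ in₂ u × N₂.E u w

  E? : ∀ v w → Dec (E v w)
  E? nothing (inj₁ w) = map′ (λ e → nothing , refl , e) (λ { (nothing , _ , e) → e }) (N₁.E? nothing w)
  E? (just (inj₁ u)) (inj₁ w) = map′ (λ e → just u , refl , e) (λ { (just _ , refl , e) → e }) (N₁.E? (just u) w)
  E? (just (inj₂ u)) (inj₁ w) = no λ (u , eq , _) → in₁≢inj₂ u (sym eq)
  E? nothing (inj₂ w) = no λ { (nothing , () , _) ; (just _ , () , _) }
  E? (just (inj₁ u)) (inj₂ w) = map′ (λ { (refl , e) → nothing , refl , e }) (λ { (nothing , refl , e) → refl , e })
    ((u N₁.≟ᵂ c) ×-dec N₂.E? nothing w)
  E? (just (inj₂ u)) (inj₂ w) = map′ (λ e → just u , refl , e) (λ { (just _ , refl , e) → e }) (N₂.E? (just u) w)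

  lift₁ : ∀ {u v} → Reach N₁.E u v → Reach E (in₁ u) (in₁ v)
  lift₁ here        = here
  lift₁ (there e p) = there {w = inj₁ _} (_ , refl , e) (lift₁ p)

  lift₂ : ∀ {u v} → Reach N₂.E u v → Reach E (in₂ u) (in₂ v)
  lift₂ here        = here
  lift₂ (there e p) = there {w = inj₂ _} (_ , refl , e) (lift₂ p)

  below₂ : ∀ {w v} → Reach E (just (inj₂ w)) v → ∃ λ y → v ≡ just (inj₂ y) × Reach N₂.E (just w) (just y)
  below₂ here = _ , refl , here
  below₂ (there {w = inj₁ _} (u , eq , _) p) = contradiction (sym eq) (in₁≢inj₂ u)
  below₂ (there {w = inj₂ _} (just _ , refl , e) p) with below₂ p
  ... | y , v≡ , q = y , v≡ , there e q

  lower₁ : ∀ {a b u v} → a ≡ in₁ u → b ≡ in₁ v → Reach E a b → Reach N₁.E u v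
  lower₁ {u = u} {v} a≡ b≡ here with refl ← in₁-injective {u} {v} (trans (sym a≡) b≡) = here
  lower₁ {u = u} a≡ b≡ (there {w = inj₁ _} (u′ , a≡′ , e) p)
    with refl ← in₁-injective {u} {u′} (trans (sym a≡) a≡′) = there e (lower₁ refl b≡ p)
  lower₁ {v = v} a≡ b≡ (there {w = inj₂ _} _ p) with below₂ p
  ... | _ , b≡′ , _ = contradiction (trans (sym b≡) b≡′) (in₁≢inj₂ v)

  -- The copy of `N₂` below its root can be entered only through `c`, where the path is cut.
  lower₁₂ : ∀ {a u w} → a ≡ in₁ u → Reach E a (just (inj₂ w)) →
            Reach N₁.E u (just c) × Reach N₂.E nothing (just w)
  lower₁₂ {u = u} a≡ here = contradiction (sym a≡) (in₁≢inj₂ u)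
  lower₁₂ {u = u} a≡ (there {w = inj₁ _} (u′ , a≡′ , e) p)
    with refl ← in₁-injective {u} {u′} (trans (sym a≡) a≡′) with lower₁₂ refl p
  ... | q , r = there e q , r
  lower₁₂ {u = u} a≡ (there {w = inj₂ _} (u′ , a≡′ , e) p)
    with in-overlap u u′ (trans (sym a≡) a≡′) | below₂ p
  ... | refl , refl | _ , refl , q = here , there e q

  lower₂ : ∀ {u v} → Reach E (in₂ u) (in₂ v) → Reach N₂.E u v
  lower₂ {just _} {v} p with below₂ p
  ... | y , eq , q with refl ← in₂-injective {v} {just y} eq = q
  lower₂ {nothing} {nothing} p = here
  lower₂ {nothing} {just w}  p = proj₂ (lower₁₂ {u = just c} refl p)

  OneParent₁ : ∀ {w} → OneParent N₁.E w → OneParent E (inj₁ w)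
  OneParent₁ (u , e , only) = in₁ u , (u , refl , e) , λ { _ (y , refl , e′) → cong in₁ (only y e′) }

  OneParent₂ : ∀ {w} → OneParent N₂.E w → OneParent E (inj₂ w)
  OneParent₂ (u , e , only) = in₂ u , (u , refl , e) , λ { _ (y , refl , e′) → cong in₂ (only y e′) }

  TwoParents₁ : ∀ {w} → TwoParents N₁.E w → TwoParents E (inj₁ w)
  TwoParents₁ (u , v , u≢v , e , e′ , only) = in₁ u , in₁ v , u≢v ∘ in₁-injective , (u , refl , e) , (v , refl , e′)
    , λ { _ (y , refl , e″) → Sum.map (cong in₁) (cong in₁) (only y e″) }

  TwoParents₂ : ∀ {w} → TwoParents N₂.E w → TwoParents E (inj₂ w)
  TwoParents₂ (u , v , u≢v , e , e′ , only) = in₂ u , in₂ v , u≢v ∘ in₂-injective , (u , refl , e) , (v , refl , e′)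
    , λ { _ (y , refl , e″) → Sum.map (cong in₂) (cong in₂) (only y e″) }

  TwoParents₁⁻ : ∀ {w} → TwoParents E (inj₁ w) → TwoParents N₁.E w
  TwoParents₁⁻ (_ , _ , u≢v , (u , refl , e) , (v , refl , e′) , only) =
    u , v , u≢v ∘ cong in₁ , e , e′ ,
    λ y e″ → Sum.map in₁-injective in₁-injective (only (in₁ y) (y , refl , e″))

  TwoParents₂⁻ : ∀ {w} → TwoParents E (inj₂ w) → TwoParents N₂.E w
  TwoParents₂⁻ (_ , _ , u≢v , (u , refl , e) , (v , refl , e′) , only) =
    u , v , u≢v ∘ cong in₂ , e , e′ ,
    λ y e″ → Sum.map in₂-injective in₂-injective (only (in₂ y) (y , refl , e″))

  OneChild₁ : ∀ {v} → OneChild N₁.E v → OneChild E (in₁ v)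
  OneChild₁ (w , e) = inj₁ w , _ , refl , e

  OneChild₂ : ∀ {v} → OneChild N₂.E v → OneChild E (in₂ v)
  OneChild₂ (w , e) = inj₂ w , _ , refl , e

  TwoChildren₁ : ∀ {v} → TwoChildren N₁.E v → TwoChildren E (in₁ v)
  TwoChildren₁ (w , y , w≢y , e , e′) = inj₁ w , inj₁ y , w≢y ∘ inj₁-injective , (_ , refl , e) , (_ , refl , e′)

  TwoChildren₂ : ∀ {v} → TwoChildren N₂.E v → TwoChildren E (in₂ v)
  TwoChildren₂ (w , y , w≢y , e , e′) = inj₂ w , inj₂ y , w≢y ∘ inj₂-injective , (_ , refl , e) , (_ , refl , e′)

  -- `Separated` demands a cut vertex distinct from both hybrids, and the glue vertex has to
  -- qualify.
  c-not-hybrid : ∀ {w} → TwoParents N₁.E w → w ≢ c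
  c-not-hybrid (u , v , u≢v , e , e′ , _) refl with N₁.leaf m₀ m₀∈X₁
  ... | (_ , _ , only) , _ = u≢v (trans (only u e) (sym (only v e′)))

  ℓ : Fin n → W
  ℓ x = if M x then inj₂ (N₂.ℓ x) else inj₁ (N₁.ℓ x)

  ℓ-in : ∀ {x} → M x ≡ true → ℓ x ≡ inj₂ (N₂.ℓ x)
  ℓ-in {x} Mx rewrite Mx = refl

  ℓ-out : ∀ {x} → M x ≡ false → ℓ x ≡ inj₁ (N₁.ℓ x)
  ℓ-out {x} Mx rewrite Mx = refl

  ℓ₁≢c : ∀ {x} → X x ≡ true → M x ≡ false → N₁.ℓ x ≢ c
  ℓ₁≢c {x} Xx Mx eq with refl ← N₁.ℓ-injective (X₁⁺ x Xx Mx) m₀∈X₁ eq = true≢false (trans (sym m₀∈M) Mx)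

  -- The glue vertex takes the label of the root of `N₂`: as a leaf of `N₁` it was no common
  -- ancestor of two leaves.
  label : Maybe W → Bool
  label nothing         = N₁.label nothing
  label (just (inj₁ u)) = if does (u N₁.≟ᵂ c) then N₂.label nothing else N₁.label (just u)
  label (just (inj₂ w)) = N₂.label (just w)

  label₁ : ∀ {u} → u ≢ just c → label (in₁ u) ≡ N₁.label u
  label₁ {nothing} _   = refl
  label₁ {just u}  u≢c rewrite does-false⁺ (u N₁.≟ᵂ c) (u≢c ∘ cong just) = refl

  label₂ : ∀ u → label (in₂ u) ≡ N₂.label u
  label₂ nothing rewrite does⁺ (c N₁.≟ᵂ c) refl = refl
  label₂ (just _) = refl

  acyclic : ∀ {v w} → E v w → ¬ Reach E (just w) v
  acyclic {w = inj₁ _} (_ , refl , e) p = N₁.acyclic e (lower₁ refl refl p)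
  acyclic {w = inj₂ _} (_ , refl , e) p = N₂.acyclic e (lower₂ p)

  kind : ∀ w → (∃ λ x → X x ≡ true × ℓ x ≡ w)
             ⊎ (OneParent E w × TwoChildren E (just w))
             ⊎ (TwoParents E w × OneChild E (just w))
  kind (inj₁ w) with N₁.kind w
  ... | inj₂ (inj₁ (one , two)) = inj₂ (inj₁ (OneParent₁ one , TwoChildren₁ two))
  ... | inj₂ (inj₂ (two , one)) = inj₂ (inj₂ (TwoParents₁ two , OneChild₁ one))
  ... | inj₁ (x , x∈ , refl) with x ≟ m₀
  -- The leaf `m₀` of `N₁` becomes an inner vertex: it keeps its parent and takes over the children
  -- of the root of `N₂`.
  ...   | yes refl = inj₂ (inj₁ (OneParent₁ (proj₁ (N₁.leaf m₀ m₀∈X₁)) , TwoChildren₂ N₂.root-out))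
  ...   | no x≢m₀ = let Xx , Mx = X₁⁻ x x∈ x≢m₀ in inj₁ (x , Xx , ℓ-out Mx)
  kind (inj₂ w) with N₂.kind w
  ... | inj₁ (x , x∈ , refl)    = inj₁ (x , M⊆X x x∈ , ℓ-in x∈)
  ... | inj₂ (inj₁ (one , two)) = inj₂ (inj₁ (OneParent₂ one , TwoChildren₂ two))
  ... | inj₂ (inj₂ (two , one)) = inj₂ (inj₂ (TwoParents₂ two , OneChild₂ one))

  leaf : ∀ x → X x ≡ true → OneParent E (ℓ x) × Childless E (just (ℓ x))
  leaf x Xx with dec-bool (M x)
  ... | inj₁ Mx rewrite ℓ-in Mx = OneParent₂ (proj₁ (N₂.leaf x Mx)) , λ
        { (inj₁ w) (u , eq , _) → in₁≢inj₂ u (sym eq)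
        ; (inj₂ w) (just _ , refl , e) → proj₂ (N₂.leaf x Mx) w e }
  ... | inj₂ Mx rewrite ℓ-out Mx = OneParent₁ (proj₁ (N₁.leaf x (X₁⁺ x Xx Mx))) , λ
        { (inj₁ w) (just _ , refl , e) → proj₂ (N₁.leaf x (X₁⁺ x Xx Mx)) w e
        ; (inj₂ w) (nothing , eq , e) → ℓ₁≢c Xx Mx (inj₁-injective (just-injective eq)) }

  ℓ-injective : ∀ {x y} → X x ≡ true → X y ≡ true → ℓ x ≡ ℓ y → x ≡ y
  ℓ-injective {x} {y} Xx Xy eq with dec-bool (M x) | dec-bool (M y)
  ... | inj₁ Mx | inj₁ My rewrite ℓ-in Mx | ℓ-in My = N₂.ℓ-injective Mx My (inj₂-injective eq)
  ... | inj₂ Mx | inj₂ My rewrite ℓ-out Mx | ℓ-out My =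
        N₁.ℓ-injective (X₁⁺ x Xx Mx) (X₁⁺ y Xy My) (inj₁-injective eq)
  ... | inj₁ Mx | inj₂ My rewrite ℓ-in Mx | ℓ-out My with () ← eq
  ... | inj₂ Mx | inj₁ My rewrite ℓ-out Mx | ℓ-in My with () ← eq

  -- A cut of `N₁` survives if all of `N₂` follows `c`; for `side₂`, all of `N₁` follows the root of
  -- `N₂`.
  side₁ : (Maybe N₁.W → Bool) → Maybe W → Bool
  side₁ s nothing         = s nothing
  side₁ s (just (inj₁ u)) = s (just u)
  side₁ s (just (inj₂ _)) = s (just c)

  side₁-in₁ : ∀ s u → side₁ s (in₁ u) ≡ s u
  side₁-in₁ s nothing  = refl
  side₁-in₁ s (just _) = refl

  side₁-in₂ : ∀ s u → side₁ s (in₂ u) ≡ s (just c)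
  side₁-in₂ s nothing  = refl
  side₁-in₂ s (just _) = refl

  side₂ : (Maybe N₂.W → Bool) → Maybe W → Bool
  side₂ s nothing         = s nothing
  side₂ s (just (inj₁ _)) = s nothing
  side₂ s (just (inj₂ w)) = s (just w)

  side₂-in₁ : ∀ s u → side₂ s (in₁ u) ≡ s nothing
  side₂-in₁ s nothing  = refl
  side₂-in₁ s (just _) = refl

  side₂-in₂ : ∀ s u → side₂ s (in₂ u) ≡ s u
  side₂-in₂ s nothing  = refl
  side₂-in₂ s (just _) = refl

  separated : ∀ h h′ → TwoParents E h → TwoParents E h′ → h ≢ h′ → Separated E h h′
  separated (inj₁ h) (inj₁ h′) two two′ h≢h′
    with N₁.separated h h′ (TwoParents₁⁻ two) (TwoParents₁⁻ two′) (h≢h′ ∘ cong inj₁)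
  ... | d , s , d≢h , d≢h′ , sh , sh′ , inv =
        in₁ d , side₁ s , d≢h ∘ in₁-injective , d≢h′ ∘ in₁-injective , sh , sh′ , λ
        { _ (inj₁ w) u≢ w≢ (u , refl , e) →
            trans (side₁-in₁ s u) (inv u w (u≢ ∘ cong in₁) (w≢ ∘ cong in₁) e)
        ; _ (inj₂ w) u≢ w≢ (u , refl , e) → side₁-in₂ s u }
  separated (inj₂ h) (inj₂ h′) two two′ h≢h′
    with N₂.separated h h′ (TwoParents₂⁻ two) (TwoParents₂⁻ two′) (h≢h′ ∘ cong inj₂)
  ... | d , s , d≢h , d≢h′ , sh , sh′ , inv =
        in₂ d , side₂ s , d≢h ∘ in₂-injective , d≢h′ ∘ in₂-injective , sh , sh′ , λ
        { _ (inj₁ w) u≢ w≢ (u , refl , e) → side₂-in₁ s u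
        ; _ (inj₂ w) u≢ w≢ (u , refl , e) →
            trans (side₂-in₂ s u) (inv u w (u≢ ∘ cong in₂) (w≢ ∘ cong in₂) e) }
  separated (inj₁ h) (inj₂ h′) two two′ _ =
    -- Hybrids of different networks are separated by the glue vertex.
    just (inj₁ c) , side₂ (Maybe.is-nothing) , (λ { refl → c-not-hybrid (TwoParents₁⁻ two) refl }) , (λ ())
    , refl , refl , λ
      { _ (inj₁ w) u≢ w≢ (u , refl , e) → side₂-in₁ Maybe.is-nothing u
      ; _ (inj₂ w) u≢ w≢ (nothing , refl , e) → contradiction refl u≢
      ; _ (inj₂ w) u≢ w≢ (just _ , refl , e) → refl }
  separated (inj₂ h) (inj₁ h′) two two′ _ =
    just (inj₁ c) , side₂ (Maybe.is-just) , (λ ()) , (λ { refl → c-not-hybrid (TwoParents₁⁻ two′) refl })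
    , refl , refl , λ
      { _ (inj₁ w) u≢ w≢ (u , refl , e) → side₂-in₁ Maybe.is-just u
      ; _ (inj₂ w) u≢ w≢ (nothing , refl , e) → contradiction refl u≢
      ; _ (inj₂ w) u≢ w≢ (just _ , refl , e) → refl }

  not-c : ∀ {u x} → X x ≡ true → M x ≡ false → Reach N₁.E u (just (N₁.ℓ x)) → u ≢ just c
  not-c Xx Mx p refl = ℓ₁≢c Xx Mx (just-injective (childless-reach N₁.E c-childless p))

  -- Every common ancestor from `N₁` is above `c`, itself a common ancestor; minimality therefore
  -- places `v` in the image of `N₂`.
  explains-in : ∀ x y → M x ≡ true → M y ≡ true → x ≢ y → ∀ v →
    MinimalCommonAncestor E (just (inj₂ (N₂.ℓ x))) (just (inj₂ (N₂.ℓ y))) v → adj G x y ≡ label v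
  explains-in x y Mx My x≢y v mca@(Px , Py , least) = at (image v mca)
    where
    image : ∀ v → MinimalCommonAncestor E _ _ v → ∃ λ u → v ≡ in₂ u
    image (just (inj₂ w)) _ = just w , refl
    image nothing (Px , Py , least) = let p , px = lower₁₂ {u = nothing} refl Px ; _ , py = lower₁₂ {u = nothing} refl Py in
      nothing , sym (least (in₂ nothing) (lift₂ px) (lift₂ py) (lift₁ p))
    image (just (inj₁ u)) (Px , Py , least) = let p , px = lower₁₂ {u = just u} refl Px ; _ , py = lower₁₂ {u = just u} refl Py in
      nothing , sym (least (in₂ nothing) (lift₂ px) (lift₂ py) (lift₁ p))
    at : (∃ λ u → v ≡ in₂ u) → adj G x y ≡ label v
    at (u , refl) = trans (N₂.explains x y Mx My x≢y u (lower₂ Px , lower₂ Py ,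
      λ u′ p q r → in₂-injective (least (in₂ u′) (lift₂ p) (lift₂ q) (lift₂ r)))) (sym (label₂ u))

  above₁ : ∀ v {w} → Reach E v (just (inj₁ w)) → ∃ λ u → v ≡ in₁ u
  above₁ nothing         _ = nothing , refl
  above₁ (just (inj₁ u)) _ = just u , refl
  above₁ (just (inj₂ w)) p with below₂ p
  ... | _ , () , _

  -- `c` represents all of `M`: the ancestor is already minimal for `m₀` and `y` in `N₁`, and the
  -- module property exchanges `m₀` for `x`.
  explains-across : ∀ x y → M x ≡ true → X y ≡ true → M y ≡ false → ∀ v →
    MinimalCommonAncestor E (just (inj₂ (N₂.ℓ x))) (just (inj₁ (N₁.ℓ y))) v → adj G x y ≡ label v
  explains-across x y Mx Xy My v (Px , Py , least) with above₁ v Py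
  ... | u , refl with lower₁₂ refl Px
  ...   | p , px = trans (module-M x m₀ y Mx m₀∈M Xy My) (trans
            (N₁.explains m₀ y m₀∈X₁ (X₁⁺ y Xy My) (λ { refl → true≢false (trans (sym m₀∈M) My) }) u
              (p , q , λ u′ a b d → in₁-injective (least (in₁ u′) (lift₁ a ++ʳ lift₂ px) (lift₁ b) (lift₁ d))))
            (sym (label₁ (not-c Xy My q))))
    where
    q : Reach N₁.E u (just (N₁.ℓ y))
    q = lower₁ refl refl Py

  explains-out : ∀ x y → X x ≡ true → M x ≡ false → X y ≡ true → M y ≡ false → x ≢ y → ∀ v →
    MinimalCommonAncestor E (just (inj₁ (N₁.ℓ x))) (just (inj₁ (N₁.ℓ y))) v → adj G x y ≡ label v
  explains-out x y Xx Mx Xy My x≢y v (Px , Py , least) with above₁ v Py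
  ... | u , refl = trans
      (N₁.explains x y (X₁⁺ x Xx Mx) (X₁⁺ y Xy My) x≢y u (lower₁ refl refl Px , q
        , λ u′ a b d → in₁-injective (least (in₁ u′) (lift₁ a) (lift₁ b) (lift₁ d))))
      (sym (label₁ (not-c Xy My q)))
    where
    q : Reach N₁.E u (just (N₁.ℓ y))
    q = lower₁ refl refl Py

  explains : ∀ x y → X x ≡ true → X y ≡ true → x ≢ y → ∀ v →
             MinimalCommonAncestor E (just (ℓ x)) (just (ℓ y)) v → adj G x y ≡ label v
  explains x y Xx Xy x≢y v mca with dec-bool (M x) | dec-bool (M y)
  ... | inj₁ Mx | inj₁ My rewrite ℓ-in Mx | ℓ-in My = explains-in x y Mx My x≢y v mca
  ... | inj₁ Mx | inj₂ My rewrite ℓ-in Mx | ℓ-out My = explains-across x y Mx Xy My v mca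
  ... | inj₂ Mx | inj₁ My rewrite ℓ-out Mx | ℓ-in My =
        let Px , Py , least = mca in
        trans (adj-sym G x y) (explains-across y x My Xx Mx v (Py , Px , λ u p q → least u q p))
  ... | inj₂ Mx | inj₂ My rewrite ℓ-out Mx | ℓ-out My = explains-out x y Xx Mx Xy My x≢y v mca

  net : Net G X
  net = record
    { W = W ; size = N₁.size + N₂.size
    ; finite = ↔-sym Fin.+↔⊎ ↔-∘ (N₁.finite ⊎-↔ N₂.finite)
    ; E = E ; E? = E? ; ℓ = ℓ ; label = label ; acyclic = acyclic
    ; root-out = TwoChildren₁ N₁.root-out
    ; kind = kind ; leaf = leaf ; ℓ-injective = ℓ-injective ; separated = separated ; explains = explains }

-- Numbering a network as a galled-tree

count-one : ∀ {k} {p : Fin k → Bool} a → p a ≡ true → (∀ b → p b ≡ true → b ≡ a) → count p ≡ 1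
count-one {p = p} a pa only = trans (count-remove p a pa)
  (cong suc (count-none λ b → ¬true⇒false λ r → let pb , b≢a = remove⁻ p a b r in b≢a (only b pb)))

count-two : ∀ {k} {p : Fin k → Bool} a b → a ≢ b → p a ≡ true → p b ≡ true →
            (∀ c → p c ≡ true → c ≡ a ⊎ c ≡ b) → count p ≡ 2
count-two {p = p} a b a≢b pa pb only = trans (count-remove p a pa)
  (cong suc (count-one {p = remove p a} b (remove⁺ p a b pb (a≢b ∘ sym)) λ c r →
    let pc , c≢a = remove⁻ p a c r in Sum.fromInj₂ (λ c≡a → contradiction c≡a c≢a) (only c pc)))

module ToGalledTree {n} (1≤n : 1 ≤ n) (G : Graph n) (N : Net G (λ _ → true)) where

  open Net N using (W; size; finite; E?; label; root-out; kind; leaf; separated)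
  private module N = Net N

  k : ℕ
  k = suc size

  decode : Fin k → Maybe W
  decode zero    = nothing
  decode (suc i) = just (Inverse.from finite i)

  encode : Maybe W → Fin k
  encode nothing  = zero
  encode (just w) = suc (Inverse.to finite w)

  decode-encode : ∀ v → decode (encode v) ≡ v
  decode-encode nothing  = refl
  decode-encode (just w) = cong just (Inverse.strictlyInverseʳ finite w)

  encode-decode : ∀ u → encode (decode u) ≡ u
  encode-decode zero    = refl
  encode-decode (suc i) = cong suc (Inverse.strictlyInverseˡ finite i)

  encode-injective : ∀ {u v} → encode u ≡ encode v → u ≡ v
  encode-injective eq = trans (sym (decode-encode _)) (trans (cong decode eq) (decode-encode _))

  decode-injective : ∀ {u v} → decode u ≡ decode v → u ≡ v
  decode-injective eq = trans (sym (encode-decode _)) (trans (cong encode eq) (encode-decode _))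

  Arrow : Maybe W → Maybe W → Set
  Arrow v nothing  = ⊥
  Arrow v (just w) = N.E v w

  arrow? : ∀ v w → Dec (Arrow v w)
  arrow? v nothing  = no id
  arrow? v (just w) = E? v w

  E : DEdges k
  E u v = does (arrow? (decode u) (decode v))

  E⁻ : ∀ {u v} → E u v ≡ true → Arrow (decode u) (decode v)
  E⁻ {u} {v} = does⁻ (arrow? (decode u) (decode v))

  E⁺ : ∀ {v w} → N.E v w → E (encode v) (encode (just w)) ≡ true
  E⁺ {v} {w} e = does⁺ (arrow? (decode (encode v)) (decode (encode (just w))))
    (subst (λ v → Arrow v (decode (encode (just w)))) (sym (decode-encode v))
      (subst (Arrow v) (sym (decode-encode (just w))) e))

  arrow-reach : ∀ {u v w} → Arrow u v → Reach N.E v w → Reach N.E u w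
  arrow-reach {v = just _} e p = there e p

  path⇒reach : ∀ {u v} → Path E u v → Reach N.E (decode u) (decode v)
  path⇒reach here        = here
  path⇒reach (there {u} {v} e p) = arrow-reach {v = decode v} (E⁻ {u} {v} e) (path⇒reach p)

  reach⇒path : ∀ {u v} → Reach N.E u v → Path E (encode u) (encode v)
  reach⇒path here        = here
  reach⇒path (there e p) = there (E⁺ e) (reach⇒path p)

  acyclic : Acyclic E
  acyclic u v e p = cyclic (decode v) (E⁻ {u} {v} e) (path⇒reach p)
    where
    cyclic : ∀ v → Arrow (decode u) v → ¬ Reach N.E v (decode u)
    cyclic (just _) = N.acyclic

  E-into : ∀ {u w} → E u (encode (just w)) ≡ true → N.E (decode u) w
  E-into {u} {w} e = subst (Arrow (decode u)) (decode-encode (just w)) (E⁻ {u} {encode (just w)} e)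

  ≡encode : ∀ {u v} → decode u ≡ v → u ≡ encode v
  ≡encode eq = trans (sym (encode-decode _)) (cong encode eq)

  indeg-one : ∀ {w} → OneParent N.E w → indeg E (encode (just w)) ≡ 1
  indeg-one {w} (u , e , only) = count-one {p = λ x → E x (encode (just w))} (encode u) (E⁺ e)
    λ b eb → ≡encode (only (decode b) (E-into eb))

  indeg-two : ∀ {w} → TwoParents N.E w → indeg E (encode (just w)) ≡ 2
  indeg-two {w} (u , v , u≢v , e , e′ , only) = count-two {p = λ x → E x (encode (just w))}
    (encode u) (encode v) (u≢v ∘ encode-injective) (E⁺ e) (E⁺ e′)
    λ c ec → Sum.map ≡encode ≡encode (only (decode c) (E-into ec))

  indeg-root : indeg E zero ≡ 0
  indeg-root = count-none {p = λ x → E x zero} λ _ → refl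

  indeg-two⁻ : ∀ {w} → indeg E (encode (just w)) ≡ 2 → TwoParents N.E w
  indeg-two⁻ {w} two with 2≤count⁻ (λ x → E x (encode (just w))) (ℕ.≤-reflexive (sym two))
  ... | a , b , ea , eb , a≢b = decode a , decode b , a≢b ∘ decode-injective , E-into ea , E-into eb ,
        λ y ey → Sum.map (λ eq → trans (sym (decode-encode y)) (cong decode eq))
                         (λ eq → trans (sym (decode-encode y)) (cong decode eq))
                   (count≡2⁻ {p = λ x → E x (encode (just w))} two ea eb a≢b (E⁺ ey))

  outdeg-one : ∀ {v} → OneChild N.E v → 1 ≤ outdeg E (encode v)
  outdeg-one {v} (w , e) = 1≤count {p = E (encode v)} (encode (just w)) (E⁺ e)

  outdeg-two : ∀ {v} → TwoChildren N.E v → 2 ≤ outdeg E (encode v)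
  outdeg-two {v} (w , y , w≢y , e , e′) =
    2≤count {p = E (encode v)} (E⁺ e) (E⁺ e′) (w≢y ∘ just-injective ∘ encode-injective)

  arrow-childless : ∀ {v} → Childless N.E v → ∀ w → ¬ Arrow v w
  arrow-childless none (just w) = none w

  outdeg-none : ∀ {v} → Childless N.E v → outdeg E (encode v) ≡ 0
  outdeg-none {v} none = count-none {p = E (encode v)} λ u → ¬true⇒false λ e →
    arrow-childless none (decode u) (subst (λ v → Arrow v (decode u)) (decode-encode v) (E⁻ {encode v} {u} e))

  ℓ : Fin n → Fin k
  ℓ x = encode (just (N.ℓ x))

  ℓ-injective : Injective _≡_ _≡_ ℓ
  ℓ-injective eq = N.ℓ-injective refl refl (just-injective (encode-injective eq))

  data VertexView : Fin k → Set where
    root  : VertexView zero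
    inner : ∀ w → VertexView (encode (just w))

  vertex-view : ∀ u → VertexView u
  vertex-view zero    = root
  vertex-view (suc i) = subst VertexView (encode-decode (suc i)) (inner (Inverse.from finite i))

  parent : ∀ w → 1 ≤ indeg E (encode (just w))
  parent w with kind w
  ... | inj₁ (x , _ , refl)    = ℕ.≤-reflexive (sym (indeg-one (proj₁ (leaf x refl))))
  ... | inj₂ (inj₁ (one , _)) = ℕ.≤-reflexive (sym (indeg-one one))
  ... | inj₂ (inj₂ (two , _)) = subst (1 ≤_) (sym (indeg-two two)) (s≤s z≤n)

  only-root : ∀ u → indeg E u ≡ 0 → u ≡ zero
  only-root u none with vertex-view u
  ... | root    = refl
  ... | inner w with () ← subst (1 ≤_) none (parent w)

  degrees : ∀ v → ¬ InImage ℓ v → v ≢ zero →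
            (indeg E v ≡ 1 × 2 ≤ outdeg E v) ⊎ (indeg E v ≡ 2 × 1 ≤ outdeg E v)
  degrees v ¬leaf v≢ with vertex-view v
  ... | root = contradiction refl v≢
  ... | inner w with kind w
  ...   | inj₁ (x , _ , refl)      = contradiction (x , refl) ¬leaf
  ...   | inj₂ (inj₁ (one , out)) = inj₁ (indeg-one one , outdeg-two out)
  ...   | inj₂ (inj₂ (two , out)) = inj₂ (indeg-two two , outdeg-one out)

  leaves : ∀ x → InImage ℓ x ⇔ (outdeg E x ≡ 0 × indeg E x ≡ 1)
  leaves x = mk⇔ to from
    where
    to : InImage ℓ x → outdeg E x ≡ 0 × indeg E x ≡ 1
    to (y , refl) = outdeg-none (proj₂ (leaf y refl)) , indeg-one (proj₁ (leaf y refl))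
    from : outdeg E x ≡ 0 × indeg E x ≡ 1 → InImage ℓ x
    from (none , _) with vertex-view x
    ... | root with () ← subst (2 ≤_) none (outdeg-two root-out)
    from (none , _) | inner w with kind w
    ... | inj₁ (y , _ , refl) = y , refl
    ... | inj₂ (inj₁ (_ , out)) with () ← subst (2 ≤_) none (outdeg-two out)
    ... | inj₂ (inj₂ (_ , out)) with () ← subst (1 ≤_) none (outdeg-one out)

  arrow-side : ∀ {c} {s : Maybe W → Bool} →
    (∀ u w → u ≢ c → just w ≢ c → N.E u w → s u ≡ s (just w)) →
    ∀ u v → u ≢ c → v ≢ c → Arrow u v → s u ≡ s v
  arrow-side inv u (just w) = inv u w

  walk-side : ∀ {c} {s : Maybe W → Bool} {C} →
    (∀ u w → u ≢ c → just w ≢ c → N.E u w → s u ≡ s (just w)) →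
    ∀ {u v} → UPath E (remove C (encode c)) u v → s (decode u) ≡ s (decode v)
  walk-side inv (here _) = refl
  walk-side {c} {s} {C} inv (there {u} {v} r e p) = trans (crossing e) (walk-side {c} {s} {C} inv p)
    where
    avoids : ∀ u → remove C (encode c) u ≡ true → decode u ≢ c
    avoids u r eq = proj₂ (remove⁻ C (encode c) u r) (≡encode eq)
    crossing : E u v ≡ true ⊎ E v u ≡ true → s (decode u) ≡ s (decode v)
    crossing (inj₁ e) = arrow-side {c} {s} inv _ _ (avoids u r) (avoids v (UPath-start p)) (E⁻ {u} {v} e)
    crossing (inj₂ e) = sym (arrow-side {c} {s} inv _ _ (avoids v (UPath-start p)) (avoids u r) (E⁻ {v} {u} e))

  -- A component stays connected without the separating vertex, and no walk that avoids this vertex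
  -- changes sides.
  one-hybrid : ∀ C → BiconnectedComponent E C → ∀ h h′ →
         indeg E h ≡ 2 → C h ≡ true → (∀ u → E u h ≡ true → C u ≡ true) →
         indeg E h′ ≡ 2 → C h′ ≡ true → (∀ u → E u h′ ≡ true → C u ≡ true) → h ≡ h′
  one-hybrid C (_ , bC , _) h h′ two Ch _ two′ Ch′ _ with vertex-view h | vertex-view h′
  ... | root | _ = contradiction (trans (sym indeg-root) two) λ ()
  ... | _ | root = contradiction (trans (sym indeg-root) two′) λ ()
  ... | inner w | inner w′ = decidable-stable (_ ≟ _) λ h≢h′ →
        apart (separated w w′ (indeg-two⁻ two) (indeg-two⁻ two′) (h≢h′ ∘ cong (encode ∘ just)))
    where
    apart : ¬ Separated N.E w w′
    apart (c , s , c≢h , c≢h′ , sh , sh′ , inv) = true≢false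
      (trans (sym sh) (trans (cong s (sym (decode-encode (just w)))) (trans
        (walk-side {c} {s} {C} inv (remove-connected {S = C} bC (encode c) _ _
          (remove⁺ C _ _ Ch (c≢h ∘ sym ∘ encode-injective))
          (remove⁺ C _ _ Ch′ (c≢h′ ∘ sym ∘ encode-injective))))
        (trans (cong s (decode-encode (just w′))) sh′))))

  image? : ∀ v → Dec (InImage ℓ v)
  image? v = Fin.any? λ x → ℓ x ≟ v

  bit : Bool → Label
  bit true  = l1
  bit false = l0

  t : Fin k → Label
  t v = if does (image? v) then l⊙ else bit (label (decode v))

  t-leaf : ∀ v → t v ≡ l⊙ ⇔ InImage ℓ v
  t-leaf v with image? v
  ... | yes leaf = mk⇔ (λ _ → leaf) (λ _ → refl)
  ... | no ¬leaf = mk⇔ (λ eq → contradiction eq (bit≢ (label (decode v)))) (λ leaf → contradiction leaf ¬leaf)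
    where
    bit≢ : ∀ b → bit b ≢ l⊙
    bit≢ true  ()
    bit≢ false ()

  explains : ∀ i j → i ≢ j → ∀ w → IsLCA E (ℓ i) (ℓ j) w → adj G i j ≡ true ⇔ t w ≡ l1
  explains i j i≢j w (Pi , Pj , least) =
    subst (λ s → adj G i j ≡ true ⇔ s ≡ l1) (sym t≡) (subst (λ b → b ≡ true ⇔ bit (label (decode w)) ≡ l1) (sym adj≡) bit-⇔)
    where
    reach : ∀ {u x} → Path E u (ℓ x) → Reach N.E (decode u) (just (N.ℓ x))
    reach P = subst (Reach N.E _) (decode-encode _) (path⇒reach P)
    not-leaf : ¬ InImage ℓ w
    not-leaf (x , refl) = i≢j (trans (same Pi) (sym (same Pj)))
      where
      same : ∀ {y} → Path E (ℓ x) (ℓ y) → y ≡ x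
      same {y} P = N.ℓ-injective refl refl (just-injective (childless-reach N.E (proj₂ (leaf x refl))
        (subst (λ v → Reach N.E v (just (N.ℓ y))) (decode-encode (just (N.ℓ x))) (reach P))))
    t≡ : t w ≡ bit (label (decode w))
    t≡ rewrite does-false⁺ (image? w) not-leaf = refl
    adj≡ : adj G i j ≡ label (decode w)
    adj≡ = N.explains i j refl refl i≢j (decode w) (reach Pi , reach Pj , λ u p q r →
      trans (sym (decode-encode u)) (cong decode (least (encode u) (reach⇒path p) (reach⇒path q)
        (subst (λ w → Path E w _) (encode-decode w) (reach⇒path r)))))
    bit-⇔ : ∀ {b} → b ≡ true ⇔ bit b ≡ l1
    bit-⇔ {true}  = mk⇔ (λ _ → refl) (λ _ → refl)
    bit-⇔ {false} = mk⇔ (λ ()) (λ ())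

  gaTEx : GaTEx G
  gaTEx = k , E , ℓ , t ,
    (ℓ-injective , 1≤n , acyclic ,
      inj₂ ((zero , indeg-root , outdeg-two root-out , only-root , degrees) , leaves , one-hybrid)) ,
    t-leaf , explains

-- Networks for two leaves and for a single cycle

Maybe-↔ : ∀ {A : Set} {n} → A ↔ Fin n → Maybe A ↔ Fin (suc n)
Maybe-↔ {A} {n} A↔ = mk↔ₛ′ to from to-from from-to
  where
  open Inverse A↔ using (strictlyInverseˡ; strictlyInverseʳ)
  to : Maybe A → Fin (suc n)
  to nothing  = zero
  to (just a) = suc (Inverse.to A↔ a)
  from : Fin (suc n) → Maybe A
  from zero    = nothing
  from (suc i) = just (Inverse.from A↔ i)
  to-from : ∀ i → to (from i) ≡ i
  to-from zero    = refl
  to-from (suc i) = cong suc (strictlyInverseˡ i)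
  from-to : ∀ v → from (to v) ≡ v
  from-to nothing  = refl
  from-to (just a) = cong just (strictlyInverseʳ a)

Σ-Bool-↔ : (P : Bool → Set) → Σ Bool P ↔ (P false ⊎ P true)
Σ-Bool-↔ P = mk↔ₛ′
  (λ { (false , p) → inj₁ p ; (true , p) → inj₂ p })
  (λ { (inj₁ p) → false , p ; (inj₂ p) → true , p })
  (λ { (inj₁ p) → refl ; (inj₂ p) → refl })
  (λ { (false , p) → refl ; (true , p) → refl })

-- Two leaves are too few for `CycleData`, which has a leaf on each side and one below the hybrid. A
-- root with two leaves takes its place.
pair-net : ∀ {n} (G : Graph n) (X : Fin n → Bool) {x y} → X x ≡ true → X y ≡ true → x ≢ y →
           (∀ z → X z ≡ true → z ≡ x ⊎ z ≡ y) → Net G X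
pair-net {n} G X {x} {y} Xx Xy x≢y only = record
  { W = Bool ; size = 2
  ; finite = mk↔ₛ′ (λ { false → zero ; true → suc zero }) (λ { zero → false ; (suc zero) → true })
               (λ { zero → refl ; (suc zero) → refl }) (λ { false → refl ; true → refl })
  ; E = E ; E? = λ { nothing w → yes refl ; (just _) w → no λ () } ; ℓ = ℓ ; label = λ _ → adj G x y
  ; acyclic = λ { refl p → contradiction (childless-reach E (λ _ ()) p) λ () }
  ; root-out = false , true , (λ ()) , refl , refl
  ; kind = λ { true → inj₁ (x , Xx , does⁺ (x ≟ x) refl) ; false → inj₁ (y , Xy , does-false⁺ (y ≟ x) (x≢y ∘ sym)) }
  ; leaf = λ z _ → one {ℓ z} , λ w ()
  ; ℓ-injective = λ {a} {b} → ℓ-inj a b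
  ; separated = λ { h _ (_ , _ , u≢v , refl , refl , _) _ _ → contradiction refl u≢v }
  ; explains = λ a b Xa Xb a≢b v _ → pair a b Xa Xb a≢b }
  where
  E : Edges Bool
  E v _ = v ≡ nothing
  ℓ : Fin n → Bool
  ℓ z = does (z ≟ x)
  one : ∀ {w} → OneParent E w
  one = nothing , refl , λ _ e → e
  ℓ-inj : ∀ a b → X a ≡ true → X b ≡ true → ℓ a ≡ ℓ b → a ≡ b
  ℓ-inj a b Xa Xb eq with only a Xa | only b Xb
  ... | inj₁ refl | inj₁ refl = refl
  ... | inj₂ refl | inj₂ refl = refl
  ... | inj₁ refl | inj₂ refl = sym (does⁻ (b ≟ a) (trans (sym eq) (does⁺ (a ≟ a) refl)))
  ... | inj₂ refl | inj₁ refl = does⁻ (a ≟ b) (trans eq (does⁺ (b ≟ b) refl))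
  pair : ∀ a b → X a ≡ true → X b ≡ true → a ≢ b → adj G a b ≡ adj G x y
  pair a b Xa Xb a≢b with only a Xa | only b Xb
  ... | inj₁ refl | inj₁ refl = contradiction refl a≢b
  ... | inj₂ refl | inj₂ refl = contradiction refl a≢b
  ... | inj₁ refl | inj₂ refl = refl
  ... | inj₂ refl | inj₁ refl = adj-sym G a b

-- The leaves of a cycle: nothing hangs below the hybrid, just (b , i) hangs
-- below the i-th vertex of side b, counted from the root.
Spot : (Bool → ℕ) → Set
Spot len = Maybe (Σ Bool λ b → Fin (suc (len b)))

-- `μ` and `color` become the labels of the side vertices and of the root. Side `b` has
-- `suc (len b)` vertices, so the hybrid has two distinct parents below the root.
record CycleData {n} (G : Graph n) (X : Fin n → Bool) : Set where
  field
    len  : Bool → ℕ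
    elem : Spot len → Fin n
    spot : Fin n → Spot len
    elem-spot : ∀ x → X x ≡ true → elem (spot x) ≡ x
    spot-elem : ∀ s → spot (elem s) ≡ s
    elem∈X    : ∀ s → X (elem s) ≡ true
    μ     : ∀ b → Fin (suc (len b)) → Bool
    color    : Bool
    chain : ∀ b i j → toℕ i < toℕ j → adj G (elem (just (b , i))) (elem (just (b , j))) ≡ μ b i
    end   : ∀ b i → adj G (elem (just (b , i))) (elem nothing) ≡ μ b i
    cross : ∀ i j → adj G (elem (just (false , i))) (elem (just (true , j))) ≡ color

module CycleNet {n} (G : Graph n) (X : Fin n → Bool) (D : CycleData G X) where
  open CycleData D

  S : Set
  S = Spot len

  -- `inj₁ s` is a cycle vertex and `inj₂ s` the leaf below it; the top of the cycle is the
  -- `nothing` of `V`.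
  W : Set
  W = S ⊎ S

  V : Set
  V = Maybe W

  on : ∀ b → Fin (suc (len b)) → V
  on b i = just (inj₁ (just (b , i)))

  up : ∀ b → Fin (suc (len b)) → V
  up b zero    = nothing
  up b (suc i) = on b (inject₁ i)

  E : Edges W
  E v (inj₁ (just (b , i))) = v ≡ up b i
  E v (inj₁ nothing)        = ∃ λ b → v ≡ on b (fromℕ (len b))
  E v (inj₂ s)              = v ≡ just (inj₁ s)

  size : ℕ
  size = suc (suc (len false) + suc (len true))

  S-finite : S ↔ Fin size
  S-finite = Maybe-↔ (↔-sym Fin.+↔⊎ ↔-∘ Σ-Bool-↔ (λ b → Fin (suc (len b))))

  W-finite : W ↔ Fin (size + size)
  W-finite = ↔-sym Fin.+↔⊎ ↔-∘ (S-finite ⊎-↔ S-finite)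

  _≟ⱽ_ : DecidableEquality V
  _≟ⱽ_ = Maybe-≡-dec (via-injection (↔⇒↣ W-finite) _≟_)

  E? : ∀ v w → Dec (E v w)
  E? v (inj₁ (just (b , i))) = v ≟ⱽ up b i
  E? v (inj₁ nothing) = map′ [ false ,_ , true ,_ ]′ (λ { (false , e) → inj₁ e ; (true , e) → inj₂ e })
    ((v ≟ⱽ _) ⊎-dec (v ≟ⱽ _))
  E? v (inj₂ s) = v ≟ⱽ _

  -- A certificate of acyclicity. The sum of both lengths bounds either side, so 2 more exceeds
  -- every side vertex and 3 more also the hybrid.
  rank : V → ℕ
  rank nothing                     = 0
  rank (just (inj₁ (just (b , i)))) = suc (toℕ i)
  rank (just (inj₁ nothing))        = 2 + (len false + len true)
  rank (just (inj₂ _))              = 3 + (len false + len true)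

  len≤ : ∀ b → len b ≤ len false + len true
  len≤ false = ℕ.m≤m+n _ _
  len≤ true  = ℕ.m≤n+m _ _

  rank-increases : ∀ {v} w → E v w → rank v < rank (just w)
  rank-increases (inj₁ (just (b , zero)))  refl = s≤s z≤n
  rank-increases (inj₁ (just (b , suc i))) refl = s≤s (s≤s (ℕ.≤-reflexive (Fin.toℕ-inject₁ i)))
  rank-increases (inj₁ nothing) (b , refl) = s≤s (s≤s (subst (_≤ _) (sym (Fin.toℕ-fromℕ (len b))) (len≤ b)))
  rank-increases (inj₂ nothing) refl = ℕ.≤-refl
  rank-increases (inj₂ (just (b , i))) refl =
    s≤s (s≤s (ℕ.≤-trans (ℕ.≤-pred (Fin.toℕ<n i)) (ℕ.≤-trans (len≤ b) (ℕ.n≤1+n _))))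

  rank-mono : ∀ {u v} → Reach E u v → rank u ≤ rank v
  rank-mono here        = ℕ.≤-refl
  rank-mono (there e p) = ℕ.≤-trans (ℕ.<⇒≤ (rank-increases _ e)) (rank-mono p)

  acyclic : ∀ {v w} → E v w → ¬ Reach E (just w) v
  acyclic e p = ℕ.<-irrefl refl (ℕ.<-≤-trans (rank-increases _ e) (rank-mono p))

  one-spot : ∀ {b i} → OneParent E (inj₁ (just (b , i)))
  one-spot = _ , refl , λ _ e → e

  one-leaf : ∀ {s} → OneParent E (inj₂ s)
  one-leaf = _ , refl , λ _ e → e

  one≢two : ∀ w → OneParent E w → ¬ TwoParents E w
  one≢two _ (_ , _ , only) (u , v , u≢v , e , e′ , _) = u≢v (trans (only u e) (sym (only v e′)))

  hybrid : TwoParents E (inj₁ nothing)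
  hybrid = on false _ , on true _ , (λ ()) , (false , refl) , (true , refl) ,
    λ { _ (false , refl) → inj₁ refl ; _ (true , refl) → inj₂ refl }

  leaf-childless : ∀ s → Childless E (just (inj₂ s))
  leaf-childless s (inj₁ (just (b , zero)))  ()
  leaf-childless s (inj₁ (just (b , suc i))) ()
  leaf-childless s (inj₁ nothing) (_ , ())
  leaf-childless s (inj₂ _) ()

  ℓ : Fin n → W
  ℓ x = inj₂ (spot x)

  spot-out : ∀ b i → TwoChildren E (on b i)
  spot-out b i with view i
  ... | ‵fromℕ     = inj₂ (just (b , _)) , inj₁ nothing , (λ ()) , refl , b , refl
  ... | ‵inject₁ j = inj₂ (just (b , _)) , inj₁ (just (b , suc j)) , (λ ()) , refl , refl

  kind : ∀ w → (∃ λ x → X x ≡ true × ℓ x ≡ w)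
             ⊎ (OneParent E w × TwoChildren E (just w))
             ⊎ (TwoParents E w × OneChild E (just w))
  kind (inj₁ (just (b , i))) = inj₂ (inj₁ (one-spot , spot-out b i))
  kind (inj₁ nothing)        = inj₂ (inj₂ (hybrid , inj₂ nothing , refl))
  kind (inj₂ s)              = inj₁ (elem s , elem∈X s , cong inj₂ (spot-elem s))

  is-hybrid : ∀ w → TwoParents E w → w ≡ inj₁ nothing
  is-hybrid w@(inj₁ (just _)) two = contradiction two (one≢two w one-spot)
  is-hybrid (inj₁ nothing)  two = refl
  is-hybrid w@(inj₂ _)        two = contradiction two (one≢two w one-leaf)

  -- `color` is meant for the root; hybrid and leaves are above at most one leaf, so there it is a
  -- filler.
  label : V → Bool
  label (just (inj₁ (just (b , i)))) = μ b i
  label _                            = color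

  snoc : ∀ {u v} w → Reach E u v → E v w → Reach E u (just w)
  snoc w p e = p ++ʳ there e here

  -- The recursion runs on `r`, as `inject₁ j` is not structurally smaller than `suc j`.
  down : ∀ b {i} r j → toℕ j ≡ r → toℕ i ≤ toℕ j → Reach E (on b i) (on b j)
  down b {zero}  r zero _ _ = here
  down b {i} (suc r) (suc j) eq i≤j with ℕ.m≤n⇒m<n∨m≡n i≤j
  ... | inj₁ (s≤s i≤) = snoc (inj₁ (just (b , suc j)))
          (down b r (inject₁ j) (trans (Fin.toℕ-inject₁ j) (ℕ.suc-injective eq)) (subst (toℕ i ≤_) (sym (Fin.toℕ-inject₁ j)) i≤)) refl
  ... | inj₂ i≡j with refl ← Fin.toℕ-injective i≡j = here

  down-hybrid : ∀ b i → Reach E (on b i) (just (inj₁ nothing))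
  down-hybrid b i = snoc (inj₁ nothing) (down b _ (fromℕ (len b)) refl (Fin.≤fromℕ i)) (b , refl)

  spot-above : ∀ {b v i} → Reach E v (on b i) → v ≡ nothing ⊎ ∃ λ j → v ≡ on b j
  spot-above here = inj₂ (_ , refl)
  spot-above (there e p) with spot-above p
  ... | inj₂ (zero , refl)  = inj₁ e
  ... | inj₂ (suc j , refl) = inj₂ (_ , e)

  leaf-above : ∀ {v s} → Reach E v (just (inj₂ s)) → v ≡ just (inj₂ s) ⊎ Reach E v (just (inj₁ s))
  leaf-above here = inj₁ refl
  leaf-above (there {w = w} e p) with leaf-above p
  ... | inj₂ q    = inj₂ (there e q)
  ... | inj₁ refl with refl ← e = inj₂ here

  -- One orientation for each pair of distinct spots. For `apart` it is only a convention: the least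
  -- common ancestor is then the root.
  data Above : S → S → Set where
    before : ∀ {b i j} → toℕ i < toℕ j → Above (just (b , i)) (just (b , j))
    last   : ∀ {b i} → Above (just (b , i)) nothing
    apart  : ∀ {i j} → Above (just (false , i)) (just (true , j))

  compare : ∀ s s′ → s ≡ s′ ⊎ Above s s′ ⊎ Above s′ s
  compare nothing nothing = inj₁ refl
  compare nothing (just _) = inj₂ (inj₂ last)
  compare (just _) nothing = inj₂ (inj₁ last)
  compare (just (false , i)) (just (true , j)) = inj₂ (inj₁ apart)
  compare (just (true , i)) (just (false , j)) = inj₂ (inj₂ apart)
  compare (just (false , i)) (just (false , j)) with ℕ.<-cmp (toℕ i) (toℕ j)
  ... | tri< lt _ _ = inj₂ (inj₁ (before lt))
  ... | tri≈ _ eq _ = inj₁ (cong (λ i → just (false , i)) (Fin.toℕ-injective eq))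
  ... | tri> _ _ gt = inj₂ (inj₂ (before gt))
  compare (just (true , i)) (just (true , j)) with ℕ.<-cmp (toℕ i) (toℕ j)
  ... | tri< lt _ _ = inj₂ (inj₁ (before lt))
  ... | tri≈ _ eq _ = inj₁ (cong (λ i → just (true , i)) (Fin.toℕ-injective eq))
  ... | tri> _ _ gt = inj₂ (inj₂ (before gt))

  Lca : S → S → V → Set
  Lca s s′ = MinimalCommonAncestor E (just (inj₂ s)) (just (inj₂ s′))

  spots-above : ∀ {s s′ v} → s ≢ s′ → Reach E v (just (inj₂ s)) → Reach E v (just (inj₂ s′)) →
                Reach E v (just (inj₁ s)) × Reach E v (just (inj₁ s′))
  spots-above s≢s′ p q with leaf-above p | leaf-above q
  ... | inj₂ p′   | inj₂ q′   = p′ , q′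
  ... | inj₁ refl | _         with refl ← childless-reach E (leaf-childless _) q = contradiction refl s≢s′
  ... | _         | inj₁ refl with refl ← childless-reach E (leaf-childless _) p = contradiction refl s≢s′

  -- `on b i` is a common ancestor that every other one reaches, so minimality identifies it with
  -- `v`.
  lca-above : ∀ {b i s v} → just (b , i) ≢ s → Reach E (on b i) (just (inj₁ s)) →
              Lca (just (b , i)) s v → on b i ≡ v
  lca-above {s = s} ≢s P (p , q , least) = least _ (snoc (inj₂ (just _)) here refl) (snoc (inj₂ s) P refl)
    (proj₁ (spots-above ≢s p q))

  above-label : ∀ {s s′ v} → Above s s′ → Lca s s′ v → adj G (elem s) (elem s′) ≡ label v
  above-label (before {b} {i} {j} i<j) lca
    with refl ← lca-above (λ { refl → ℕ.<-irrefl refl i<j }) (down b _ j refl (ℕ.<⇒≤ i<j)) lca = chain b i j i<j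
  above-label (last {b} {i}) lca with refl ← lca-above (λ ()) (down-hybrid b i) lca = end b i
  above-label (apart {i} {j}) (p , q , least) with spots-above (λ ()) p q
  ... | p′ , q′ with spot-above p′ | spot-above q′
  ...   | inj₁ refl       | _         = cross i j
  ...   | _               | inj₁ refl = cross i j
  ...   | inj₂ (_ , refl) | inj₂ (_ , ())

  explains : ∀ x y → X x ≡ true → X y ≡ true → x ≢ y → ∀ v → Lca (spot x) (spot y) v → adj G x y ≡ label v
  explains x y Xx Xy x≢y v lca@(p , q , least) = trans (sym (cong₂ (adj G) (elem-spot x Xx) (elem-spot y Xy)))
    (cases (compare (spot x) (spot y)))
    where
    cases : spot x ≡ spot y ⊎ Above (spot x) (spot y) ⊎ Above (spot y) (spot x) →
            adj G (elem (spot x)) (elem (spot y)) ≡ label v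
    cases (inj₁ eq) = contradiction
      (trans (sym (elem-spot x Xx)) (trans (cong elem eq) (elem-spot y Xy))) x≢y
    cases (inj₂ (inj₁ above)) = above-label above lca
    cases (inj₂ (inj₂ above)) = trans (adj-sym G _ _) (above-label above (q , p , λ u a b → least u b a))

  net : Net G X
  net = record
    { W = W ; size = size + size ; finite = W-finite ; E = E ; E? = E? ; ℓ = ℓ ; label = label
    ; acyclic = acyclic
    ; root-out = inj₁ (just (false , zero)) , inj₁ (just (true , zero)) , (λ ()) , refl , refl
    ; kind = kind
    ; leaf = λ x _ → one-leaf , leaf-childless (spot x)
    ; ℓ-injective = λ {x} {y} Xx Xy eq →
        trans (sym (elem-spot x Xx)) (trans (cong elem (inj₂-injective eq)) (elem-spot y Xy))
    ; separated = λ h h′ two two′ h≢h′ → contradiction (trans (is-hybrid h two) (sym (is-hybrid h′ two′))) h≢h′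
    ; explains = explains }

-- Cographs

separate : ∀ {n} (G : Graph n) {p x y} → adj G p x ≡ true → adj G p y ≡ false → x ≢ y
separate G px py refl = true≢false (trans (sym px) py)

-- Any two vertices of a P4 are told apart by the adjacency of a third, so distinctness need not be
-- assumed.
P4-injective : ∀ {n} (G : Graph n) (f : Fin 4 → Fin n) → InducedP4 G f → Injective _≡_ _≡_ f
P4-injective G f (e01 , e12 , e23 , n02 , n03 , n13) {i} {j} = inj i j
  where
  f0≢f1 : f zero ≢ f (suc zero)
  f0≢f1 = separate G (trans (adj-sym G _ _) e12) (trans (adj-sym G _ _) n02) ∘ sym
  f0≢f2 : f zero ≢ f (suc (suc zero))
  f0≢f2 = separate G (trans (adj-sym G _ _) e23) (trans (adj-sym G _ _) n03) ∘ sym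
  f0≢f3 : f zero ≢ f (suc (suc (suc zero)))
  f0≢f3 = separate G (trans (adj-sym G _ _) e01) n13
  f1≢f2 : f (suc zero) ≢ f (suc (suc zero))
  f1≢f2 = separate G e01 n02
  f1≢f3 : f (suc zero) ≢ f (suc (suc (suc zero)))
  f1≢f3 = separate G e01 n03
  f2≢f3 : f (suc (suc zero)) ≢ f (suc (suc (suc zero)))
  f2≢f3 = separate G e12 n13
  inj : ∀ i j → f i ≡ f j → i ≡ j
  inj zero zero _ = refl
  inj (suc zero) (suc zero) _ = refl
  inj (suc (suc zero)) (suc (suc zero)) _ = refl
  inj (suc (suc (suc zero))) (suc (suc (suc zero))) _ = refl
  inj zero (suc zero) eq = contradiction eq f0≢f1
  inj zero (suc (suc zero)) eq = contradiction eq f0≢f2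
  inj zero (suc (suc (suc zero))) eq = contradiction eq f0≢f3
  inj (suc zero) (suc (suc zero)) eq = contradiction eq f1≢f2
  inj (suc zero) (suc (suc (suc zero))) eq = contradiction eq f1≢f3
  inj (suc (suc zero)) (suc (suc (suc zero))) eq = contradiction eq f2≢f3
  inj (suc zero) zero eq = contradiction (sym eq) f0≢f1
  inj (suc (suc zero)) zero eq = contradiction (sym eq) f0≢f2
  inj (suc (suc (suc zero))) zero eq = contradiction (sym eq) f0≢f3
  inj (suc (suc zero)) (suc zero) eq = contradiction (sym eq) f1≢f2
  inj (suc (suc (suc zero))) (suc zero) eq = contradiction (sym eq) f1≢f3
  inj (suc (suc (suc zero))) (suc (suc zero)) eq = contradiction (sym eq) f2≢f3

quadruple : ∀ {n} (a b c d : Fin n) → Fin 4 → Fin n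
quadruple a b c d zero                   = a
quadruple a b c d (suc zero)             = b
quadruple a b c d (suc (suc zero))       = c
quadruple a b c d (suc (suc (suc zero))) = d

-- γ = false is covered because the complement of a P4 is again a P4.
no-P4 : ∀ {n} (G : Graph n) → Cograph G → ∀ γ {a b c d} →
        adj G a b ≡ γ → adj G b c ≡ γ → adj G c d ≡ γ →
        adj G a c ≡ not γ → adj G a d ≡ not γ → adj G b d ≡ not γ → ⊥
no-P4 G cog true {a} {b} {c} {d} ab bc cd ac ad bd = cog f (P4-injective G f p4) p4
  where
  f : Fin 4 → Fin _
  f = quadruple a b c d
  p4 : InducedP4 G f
  p4 = ab , bc , cd , ac , ad , bd
no-P4 G cog false {a} {b} {c} {d} ab bc cd ac ad bd = cog f (P4-injective G f p4) p4
  where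
  f : Fin 4 → Fin _
  -- The complement of the path `a b c d` is the path `c a d b`.
  f = quadruple c a d b
  p4 : InducedP4 G f
  p4 = trans (adj-sym G c a) ac , ad , trans (adj-sym G d b) bd , cd , trans (adj-sym G c b) bc , ab

Cograph-induced : ∀ {n m} (G : Graph n) (f : Fin m → Fin n) → Injective _≡_ _≡_ f →
                  Cograph G → Cograph (induced G f)
Cograph-induced G f f-inj cog p p-inj = cog (f ∘ p) (p-inj ∘ f-inj)

record Split {n} (G : Graph n) : Set where
  constructor split
  field
    part    : Fin n → Bool
    color   : Bool
    {inside outside} : Fin n
    in-part  : part inside ≡ true
    out-part : part outside ≡ false
    uniform : ∀ a b → part a ≡ true → part b ≡ false → adj G a b ≡ color

Split-swap : ∀ {n} {G : Graph n} → Split G → Split G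
Split-swap {G = G} (split part color i o uniform) = split (not ∘ part) color (cong not o) (cong not i)
  λ a b pa pb → trans (adj-sym G a b) (uniform b a (unnot pb) (unnot pa))
  where
  unnot : ∀ {b c} → not b ≡ c → b ≡ not c
  unnot {true}  refl = refl
  unnot {false} refl = refl

≢⇒≡not : ∀ {b c : Bool} → b ≢ c → b ≡ not c
≢⇒≡not {true}  {true}  ≢ = contradiction refl ≢
≢⇒≡not {true}  {false} _ = refl
≢⇒≡not {false} {true}  _ = refl
≢⇒≡not {false} {false} ≢ = contradiction refl ≢

consᶠ : ∀ {A : Set} {n} → A → (Fin n → A) → Fin (suc n) → A
consᶠ a f zero    = a
consᶠ a f (suc i) = f i

-- Extending a split by one vertex x; opposed vertices are those joined to x
-- in the color other than that of the split.
module Extend {n} (G : Graph (suc n)) (cog : Cograph G) where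
  x : Fin (suc n)
  x = zero

  module _ (s : Split (induced G suc)) where
    open Split s

    Opposed : Fin n → Set
    Opposed y = adj G x (suc y) ≢ color

    opposed? : ∀ y → Dec (Opposed y)
    opposed? y = ¬? (adj G x (suc y) Bool.≟ color)

    add-outside : (∀ a → part a ≡ true → ¬ Opposed a) → Split G
    add-outside none = split (consᶠ false part) color {suc inside} {suc outside} in-part out-part uni
      where
      uni : ∀ a b → consᶠ false part a ≡ true → consᶠ false part b ≡ false → adj G a b ≡ color
      uni (suc a) (suc b) pa pb = uniform a b pa pb
      uni (suc a) zero    pa _  = trans (adj-sym G _ _) (decidable-stable (_ Bool.≟ _) (none a pa))

    -- The unopposed vertices of `part` form the new part. A wrong adjacency between an unopposed
    -- `a` and an opposed `c` of `part` would make `a c x b` a path on four vertices in the colour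
    -- `not color`.
    unopposed-part : ∀ {z b} → part z ≡ true → ¬ Opposed z → part b ≡ false → Opposed b → Split G
    unopposed-part {z} {b} pz ¬oz pb ob = split (does ∘ P?) color {suc z} {x}
      (does⁺ (P? (suc z)) (z , refl , pz , ¬oz)) (does-false⁺ (P? x) λ { (_ , () , _) }) uni
      where
      P? : ∀ y → Dec (∃ λ z → y ≡ suc z × part z ≡ true × ¬ Opposed z)
      P? zero    = no λ { (_ , () , _) }
      P? (suc y) = map′ (λ (p , o) → y , refl , p , o) (λ { (_ , refl , p , o) → p , o })
        ((part y Bool.≟ true) ×-dec ¬? (opposed? y))
      plain : ∀ {y} → ¬ Opposed y → adj G x (suc y) ≡ color
      plain = decidable-stable (_ Bool.≟ _)
      uni : ∀ a c → does (P? a) ≡ true → does (P? c) ≡ false → adj G a c ≡ color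
      uni a c Pa Pc with does⁻ (P? a) Pa
      uni _ zero    _ _  | a , refl , pa , ¬oa = trans (adj-sym G _ _) (plain ¬oa)
      uni _ (suc c) _ Pc | a , refl , pa , ¬oa with dec-bool (part c)
      ... | inj₂ ¬pc = uniform a c pa ¬pc
      ... | inj₁ pc with opposed? c
      ...   | no ¬oc = contradiction (c , refl , pc , ¬oc) (does-false⁻ (P? (suc c)) Pc)
      ...   | yes oc = decidable-stable (_ Bool.≟ _) λ ac≢ → no-P4 G cog (not color)
                {suc a} {suc c} {x} {suc b}
                (≢⇒≡not ac≢) (trans (adj-sym G _ _) (≢⇒≡not oc)) (≢⇒≡not ob)
                (nn (trans (adj-sym G _ _) (plain ¬oa))) (nn (uniform a b pa pb)) (nn (uniform c b pc pb))
        where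
        nn : ∀ {e} → e ≡ color → e ≡ not (not color)
        nn eq with color
        ... | true  = eq
        ... | false = eq

    all-opposed : (∀ y → Opposed y) → Split G
    all-opposed all = split (consᶠ true (λ _ → false)) (not color) {x} {suc inside} refl refl
      λ { zero (suc b) _ _ → ≢⇒≡not (all b) }

    search : ∀ β → Dec (∃ λ a → part a ≡ β × Opposed a)
    search β = Fin.any? λ a → (part a Bool.≟ β) ×-dec opposed? a

  -- If one side has no opposed vertex, `x` joins the other side. If all vertices are opposed, `x`
  -- is split off alone. Otherwise a side with an unopposed vertex faces an opposed one, and its
  -- unopposed vertices are split off.
  extend : Split (induced G suc) → Split G
  extend s with search s true | search s false
  ... | no none | _ = add-outside s λ a pa oa → none (a , pa , oa)
  ... | yes _ | no none = add-outside (Split-swap s) λ a pa oa → none (a , unnot pa , oa)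
    where
    unnot : ∀ {b} → not b ≡ true → b ≡ false
    unnot {false} refl = refl
  ... | yes (a , pa , oa) | yes (b , pb , ob) with Fin.any? (λ z → ¬? (opposed? s z))
  ...   | no none = all-opposed s λ y → decidable-stable (opposed? s y) λ ¬oy → none (y , ¬oy)
  ...   | yes (z , ¬oz) with dec-bool (Split.part s z)
  ...     | inj₁ pz = unopposed-part s pz ¬oz pb ob
  ...     | inj₂ pz = unopposed-part (Split-swap s) (cong not pz) ¬oz (cong not pa) oa

cograph-split : ∀ n (G : Graph (suc (suc n))) → Cograph G → Split G
cograph-split zero G cog = split (consᶠ true (λ _ → false)) (adj G zero (suc zero)) {zero} {suc zero} refl refl
  λ { zero (suc zero) _ _ → refl }
cograph-split (suc n) G cog = Extend.extend G cog
  (cograph-split n (induced G suc) (Cograph-induced G suc Fin.suc-injective cog))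

-- The part must avoid `v`, since only then do the vertices outside the cograph fail to distinguish
-- its members.
cograph-split-off : ∀ n (G : Graph (suc (suc n))) → Cograph G → ∀ v →
                    Σ (Split G) λ s → Split.part s v ≡ false
cograph-split-off n G cog v with cograph-split n G cog
... | s with dec-bool (Split.part s v)
...   | inj₂ out = s , out
...   | inj₁ inn = Split-swap s , cong not inn

-- us orders the image of g without v such that each vertex is uniform
-- towards its successors and v: one side of a galled cycle, read from the root.
record Caterpillar {m} (H : Graph m) (v : Fin m) {p} (g : Fin (suc p) → Fin m) : Set where
  field
    us : Fin p → Fin m
    us-injective : Injective _≡_ _≡_ us
    us≢v  : ∀ i → us i ≢ v
    us-in : ∀ i → InImage g (us i)
    us-onto : ∀ y → InImage g y → y ≢ v → InImage us y
    μ     : Fin p → Bool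
    chain : ∀ i j → toℕ i < toℕ j → adj H (us i) (us j) ≡ μ i
    end   : ∀ i → adj H (us i) v ≡ μ i

-- `outer` is the invariant: no vertex outside the image distinguishes image vertices other than
-- `g i₀`. With a split it makes the part without `i₀` a module of `H`, hence the single vertex
-- `i₁`, which heads the order of the rest.
caterpillar : ∀ {m} (H : Graph m) → Primitive H → ∀ {p} (g : Fin (suc p) → Fin m) → Injective _≡_ _≡_ g →
  Cograph (induced H g) → ∀ i₀ →
  (∀ y → ¬ InImage g y → ∀ a b → a ≢ i₀ → b ≢ i₀ → adj H y (g a) ≡ adj H y (g b)) →
  Caterpillar H (g i₀) g
caterpillar H prim {zero} g g-inj cog zero outer = record
  { us = λ () ; us-injective = λ {} ; us≢v = λ () ; us-in = λ ()
  ; us-onto = λ { _ (zero , refl) y≢v → contradiction refl y≢v }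
  ; μ = λ () ; chain = λ () ; end = λ () }
caterpillar H prim {suc p} g g-inj cog i₀ outer with cograph-split-off p (induced H g) cog i₀
... | split A β {i₁} A₁ _ uniform , A₀ = record
  { us = consᶠ (g i₁) R.us ; us-injective = λ {i} {j} → inj i j
  ; us≢v = λ { zero eq → i₁≢i₀ (g-inj eq) ; (suc i) eq → R.us≢v i (trans eq (sym v≡)) }
  ; us-in = λ { zero → i₁ , refl ; (suc i) → let a , eq = R.us-in i in punchIn i₁ a , eq }
  ; us-onto = onto
  ; μ = consᶠ β R.μ
  ; chain = λ { zero (suc j) _ → toward-i₁ (R.us-in j) ; (suc i) (suc j) (s≤s i<j) → R.chain i j i<j }
  ; end = λ { zero → trans (cong (adj H (g i₁)) (sym v≡)) (toward-i₁ (i₀′ , refl))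
            ; (suc i) → trans (cong (adj H (R.us i)) (sym v≡)) (R.end i) } }
  where
  i₁≢i₀ : i₁ ≢ i₀
  i₁≢i₀ refl = true≢false (trans (sym A₁) A₀)

  M? : ∀ y → Dec (∃ λ i → g i ≡ y × A i ≡ true)
  M? y = Fin.any? λ i → (g i ≟ y) ×-dec (A i Bool.≟ true)

  M-module : IsModule H (does ∘ M?)
  M-module x y z Mx My Mz with does⁻ (M? x) Mx | does⁻ (M? y) My | Fin.any? (λ i → g i ≟ z)
  ... | a , refl , Aa | b , refl , Ab | yes (c , refl) = trans (uniform a c Aa Ac) (sym (uniform b c Ab Ac))
    where
    Ac : A c ≡ false
    Ac = ¬true⇒false λ Ac → does-false⁻ (M? (g c)) Mz (c , refl , Ac)
  ... | a , refl , Aa | b , refl , Ab | no ¬img = trans (adj-sym H _ _)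
        (trans (outer z ¬img a b (off Aa) (off Ab)) (adj-sym H _ _))
    where
    off : ∀ {i} → A i ≡ true → i ≢ i₀
    off Ai refl = true≢false (trans (sym Ai) A₀)

  A-single : ∀ {i} → A i ≡ true → i ≡ i₁
  A-single {i} Ai = g-inj (primitive-module H prim M-module (g i₀)
    (does⁺ (M? (g i)) (i , refl , Ai)) (does⁺ (M? (g i₁)) (i₁ , refl , A₁))
    (does-false⁺ (M? (g i₀)) λ (j , eq , Aj) → true≢false (trans (sym Aj) (trans (cong A (g-inj eq)) A₀))))

  A-rest : ∀ a → A (punchIn i₁ a) ≡ false
  A-rest a = ¬true⇒false λ Aa → Fin.punchInᵢ≢i i₁ a (A-single Aa)

  g′ : Fin (suc p) → Fin _
  g′ = g ∘ punchIn i₁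

  i₀′ : Fin (suc p)
  i₀′ = punchOut i₁≢i₀

  v≡ : g′ i₀′ ≡ g i₀
  v≡ = cong g (Fin.punchIn-punchOut i₁≢i₀)

  toward-i₁ : ∀ {y} → InImage g′ y → adj H (g i₁) y ≡ β
  toward-i₁ (a , refl) = uniform i₁ (punchIn i₁ a) A₁ (A-rest a)

  g′-onto : ∀ {y} → InImage g y → y ≢ g i₁ → InImage g′ y
  g′-onto (a , refl) y≢ = punchOut i₁≢a , cong g (Fin.punchIn-punchOut i₁≢a)
    where
    i₁≢a : i₁ ≢ a
    i₁≢a refl = y≢ refl

  outer′ : ∀ y → ¬ InImage g′ y → ∀ a b → a ≢ i₀′ → b ≢ i₀′ → adj H y (g′ a) ≡ adj H y (g′ b)
  outer′ y ¬img a b a≢ b≢ with y ≟ g i₁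
  -- The one vertex that has newly left the image is `g i₁`, and the split makes it uniform to what
  -- remains.
  ... | yes refl = trans (toward-i₁ (a , refl)) (sym (toward-i₁ (b , refl)))
  ... | no y≢ = outer y (λ img → ¬img (g′-onto img y≢)) (punchIn i₁ a) (punchIn i₁ b) (off a≢) (off b≢)
    where
    off : ∀ {a} → a ≢ i₀′ → punchIn i₁ a ≢ i₀
    off {a} a≢ eq = a≢ (Fin.punchIn-injective i₁ a i₀′ (trans eq (sym (Fin.punchIn-punchOut i₁≢i₀))))

  rec : Caterpillar H (g′ i₀′) g′
  rec = caterpillar H prim g′ (Fin.punchIn-injective i₁ _ _ ∘ g-inj)
    (Cograph-induced (induced H g) (punchIn i₁) (Fin.punchIn-injective i₁ _ _) cog) i₀′ outer′

  module R = Caterpillar rec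

  us≢i₁ : ∀ i → R.us i ≢ g i₁
  us≢i₁ i eq = let a , ua = R.us-in i in Fin.punchInᵢ≢i i₁ a (g-inj (trans ua eq))

  inj : ∀ i j → consᶠ (g i₁) R.us i ≡ consᶠ (g i₁) R.us j → i ≡ j
  inj zero    zero    _  = refl
  inj zero    (suc j) eq = contradiction (sym eq) (us≢i₁ j)
  inj (suc i) zero    eq = contradiction eq (us≢i₁ i)
  inj (suc i) (suc j) eq = cong suc (R.us-injective eq)

  onto : ∀ y → InImage g y → y ≢ g i₀ → InImage (consᶠ (g i₁) R.us) y
  onto y img y≢v with y ≟ g i₁
  ... | yes refl = zero , refl
  ... | no y≢ = let i , eq = R.us-onto y (g′-onto img y≢) (λ eq → y≢v (trans eq v≡)) in suc i , eq

-- From primitive pseudo-cographs to cycles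

primitive⇒cycle : ∀ {m} (H : Graph m) → Primitive H → PseudoCograph H → CycleData H (λ _ → true)
primitive⇒cycle H prim (inj₁ m≤2) = contradiction (ℕ.≤-trans (proj₁ prim) m≤2) λ { (s≤s (s≤s ())) }
primitive⇒cycle {m} H prim (inj₂ (suc (suc p₁) , (f₁ , f₁-inj) , suc (suc p₂) , (f₂ , f₂-inj) , v
  , cover , (i₁ , refl) , (i₂ , i₂v) , shared , s≤s _ , s≤s _ , cog₁ , cog₂ , P3)) = record
  { len = len ; elem = elem ; spot = proj₁ ∘ locate
  ; elem-spot = λ x _ → proj₂ (locate x)
  ; spot-elem = λ s → elem-injective (proj₁ (locate (elem s))) s (proj₂ (locate (elem s)))
  ; elem∈X = λ _ → refl
  ; μ = λ { false → C₁.μ ; true → C₂.μ }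
  ; color = β
  ; chain = λ { false → C₁.chain ; true → C₂.chain }
  ; end = λ { false → C₁.end ; true → C₂.end }
  ; cross = λ i j → between (C₁.us-in i) (C₁.us≢v i) (C₂.us-in j) (C₂.us≢v j) }
  where
  constant : ∃ λ β → ∀ x y → InImage f₁ x → x ≢ v → InImage f₂ y → y ≢ v → adj H x y ≡ β
  constant = [ true ,_ , false ,_ ]′ P3
  β : Bool
  β = proj₁ constant
  between : ∀ {x y} → InImage f₁ x → x ≢ v → InImage f₂ y → y ≢ v → adj H x y ≡ β
  between {x} {y} = proj₂ constant x y

  other₁ : ∀ {y} → ¬ InImage f₁ y → InImage f₂ y × y ≢ v
  other₁ {y} ¬img = Sum.fromInj₂ (λ img → contradiction img ¬img) (cover y) , λ { refl → ¬img (i₁ , refl) }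
  other₂ : ∀ {y} → ¬ InImage f₂ y → InImage f₁ y × y ≢ v
  other₂ {y} ¬img = Sum.fromInj₁ (λ img → contradiction img ¬img) (cover y) , λ { refl → ¬img (i₂ , i₂v) }

  cat₁ : Caterpillar H v f₁
  -- A vertex outside the image of `f₁` is in that of `f₂` and is not `v`, so (P3) makes it uniform
  -- to the image of `f₁` without `v`.
  cat₁ = caterpillar H prim f₁ f₁-inj cog₁ i₁ λ y ¬img a b a≢ b≢ →
    let y₂ , y≢v = other₁ ¬img in
    trans (trans (adj-sym H _ _) (between (a , refl) (a≢ ∘ f₁-inj) y₂ y≢v))
      (sym (trans (adj-sym H _ _) (between (b , refl) (b≢ ∘ f₁-inj) y₂ y≢v)))
  cat₂ : Caterpillar H v f₂
  cat₂ = subst (λ v → Caterpillar H v f₂) i₂v (caterpillar H prim f₂ f₂-inj cog₂ i₂ λ y ¬img a b a≢ b≢ →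
    let y₁ , y≢v = other₂ ¬img in
    trans (between y₁ y≢v (a , refl) (λ eq → a≢ (f₂-inj (trans eq (sym i₂v)))))
      (sym (between y₁ y≢v (b , refl) (λ eq → b≢ (f₂-inj (trans eq (sym i₂v)))))))
  module C₁ = Caterpillar cat₁
  module C₂ = Caterpillar cat₂

  len : Bool → ℕ
  len false = p₁
  len true  = p₂

  elem : Spot len → Fin m
  elem nothing            = v
  elem (just (false , i)) = C₁.us i
  elem (just (true , i))  = C₂.us i

  locate : ∀ x → ∃ λ s → elem s ≡ x
  locate x with x ≟ v
  ... | yes refl = nothing , refl
  ... | no x≢v with cover x
  ...   | inj₁ x₁ = let i , eq = C₁.us-onto x x₁ x≢v in just (false , i) , eq
  ...   | inj₂ x₂ = let i , eq = C₂.us-onto x x₂ x≢v in just (true , i) , eq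

  apart : ∀ i j → C₁.us i ≢ C₂.us j
  apart i j eq = C₁.us≢v i (shared _ (C₁.us-in i) (subst (InImage f₂) (sym eq) (C₂.us-in j)))

  elem-injective : ∀ s s′ → elem s ≡ elem s′ → s ≡ s′
  elem-injective nothing nothing _ = refl
  elem-injective nothing (just (false , i)) eq = contradiction (sym eq) (C₁.us≢v i)
  elem-injective nothing (just (true , i))  eq = contradiction (sym eq) (C₂.us≢v i)
  elem-injective (just (false , i)) nothing eq = contradiction eq (C₁.us≢v i)
  elem-injective (just (true , i))  nothing eq = contradiction eq (C₂.us≢v i)
  elem-injective (just (false , i)) (just (false , j)) eq = cong (λ i → just (false , i)) (C₁.us-injective eq)
  elem-injective (just (true , i))  (just (true , j))  eq = cong (λ i → just (true , i)) (C₂.us-injective eq)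
  elem-injective (just (false , i)) (just (true , j))  eq = contradiction eq (apart i j)
  elem-injective (just (true , i))  (just (false , j)) eq = contradiction (sym eq) (apart j i)
primitive⇒cycle H prim (inj₂ (suc zero , _ , _ , _ , _ , _ , _ , _ , _ , s≤s () , _))
primitive⇒cycle H prim (inj₂ (suc (suc _) , _ , suc zero , _ , _ , _ , _ , _ , _ , _ , s≤s () , _))

cycle-along-enum : ∀ {n} (G : Graph n) (X : Fin n → Bool) →
                   CycleData (induced G (enum X)) (λ _ → true) → CycleData G X
cycle-along-enum {n} G X D = record
  { len = len ; elem = enum X ∘ elem ; spot = λ x → at (index x)
  ; elem-spot = λ x Xx → found x Xx (index x)
  ; spot-elem = λ s → back s (index (enum X (elem s)))
  ; elem∈X = λ s → enum-sound X (elem s)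
  ; μ = μ ; color = color ; chain = chain ; end = end ; cross = cross }
  where
  open CycleData D
  index : ∀ x → Dec (InImage (enum X) x)
  index x = Fin.any? λ i → enum X i ≟ x
  at : ∀ {x} → Dec (InImage (enum X) x) → Spot len
  at (yes (i , _)) = spot i
  -- A filler: `spot` is constrained on `X` only.
  at (no _)        = nothing
  found : ∀ x → X x ≡ true → (d : Dec (InImage (enum X) x)) → enum X (elem (at d)) ≡ x
  found x Xx (yes (i , eq)) = trans (cong (enum X) (elem-spot i refl)) eq
  found x Xx (no ¬img)      = contradiction (enum-complete X x Xx) ¬img
  back : ∀ s (d : Dec (InImage (enum X) (enum X (elem s)))) → at d ≡ s
  back s (yes (i , eq)) = trans (cong spot (enum-injective X eq)) (spot-elem s)
  back s (no ¬img)      = contradiction (elem s , refl) ¬img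

-- Nontrivial modules

Nontrivial : ∀ {m} → Graph m → (Fin m → Bool) → Set
Nontrivial H M = IsModule H M × 2 ≤ count M × ∃ λ z → M z ≡ false

nontrivial? : ∀ {m} (H : Graph m) M → Dec (Nontrivial H M)
nontrivial? H M = module? ×-dec ((2 ℕ.≤? count M) ×-dec Fin.any? λ z → M z Bool.≟ false)
  where
  module? : Dec (IsModule H M)
  module? = Fin.all? λ x → Fin.all? λ y → Fin.all? λ z →
    (M x Bool.≟ true) →-dec ((M y Bool.≟ true) →-dec ((M z Bool.≟ false) →-dec (adj H x z Bool.≟ adj H y z)))

-- The search runs over vectors, with which a Boolean function agrees only pointwise; hence the
-- transport of each condition.
search-module : ∀ {m} (H : Graph m) → (∃ λ M → Nontrivial H M) ⊎ (∀ M → ¬ Nontrivial H M)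
search-module {m} H with anySubset? (nontrivial? H ∘ lookup)
... | yes (s , nt) = inj₁ (lookup s , nt)
... | no none = inj₂ λ M (mod , two , z , Mz) →
      let same = lookup∘tabulate M ; M⁺ = λ {x} {b} (eq : lookup (tabulate M) x ≡ b) → trans (sym (same x)) eq in
      none (tabulate M , (λ x y z Mx My Mz → mod x y z (M⁺ Mx) (M⁺ My) (M⁺ Mz))
        , subst (2 ≤_) (sym (count-cong same)) two , z , trans (same z) Mz)

-- On three vertices two of the three adjacencies coincide. The two pairs share a vertex, and the
-- other two vertices form a nontrivial module.
small-or-primitive : ∀ m (H : Graph m) → (∀ M → ¬ Nontrivial H M) → 2 ≤ m → m ≡ 2 ⊎ Primitive H
small-or-primitive (suc zero) H none (s≤s ())
small-or-primitive (suc (suc zero)) H none _ = inj₁ refl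
small-or-primitive (suc (suc (suc zero))) H none _ =
  contradiction (pigeonhole (adj H v₀ v₁) (adj H v₁ v₂) (adj H v₀ v₂)) λ
    { (inj₁ eq) → uniform v₁ v₀ v₂ (λ ()) (λ ()) (λ ())
        (λ { zero _ → inj₁ refl ; (suc zero) ≢ → contradiction refl ≢ ; (suc (suc zero)) _ → inj₂ refl })
        (trans eq (adj-sym H _ _))
    ; (inj₂ (inj₁ eq)) → uniform v₀ v₁ v₂ (λ ()) (λ ()) (λ ())
        (λ { zero ≢ → contradiction refl ≢ ; (suc zero) _ → inj₁ refl ; (suc (suc zero)) _ → inj₂ refl })
        (trans (adj-sym H _ _) (trans eq (adj-sym H _ _)))
    ; (inj₂ (inj₂ eq)) → uniform v₂ v₁ v₀ (λ ()) (λ ()) (λ ())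
        (λ { zero _ → inj₂ refl ; (suc zero) _ → inj₁ refl ; (suc (suc zero)) ≢ → contradiction refl ≢ })
        eq }
  where
  v₀ v₁ v₂ : Fin 3
  v₀ = zero
  v₁ = suc zero
  v₂ = suc (suc zero)
  pigeonhole : ∀ a b c → a ≡ b ⊎ a ≡ c ⊎ b ≡ c
  pigeonhole true  true  _     = inj₁ refl
  pigeonhole false false _     = inj₁ refl
  pigeonhole true  false true  = inj₂ (inj₁ refl)
  pigeonhole false true  false = inj₂ (inj₁ refl)
  pigeonhole true  false false = inj₂ (inj₂ refl)
  pigeonhole false true  true  = inj₂ (inj₂ refl)
  uniform : ∀ z x y → x ≢ z → y ≢ z → x ≢ y → (∀ w → w ≢ z → w ≡ x ⊎ w ≡ y) → adj H x z ≢ adj H y z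
  uniform z x y x≢z y≢z x≢y others eq = none (does ∘ off)
    ( (λ a b c a∈ b∈ c∉ → subst (λ c → adj H a c ≡ adj H b c)
        (sym (decidable-stable (c ≟ z) (does-false⁻ (off c) c∉)))
        (trans (like-y (others a (does⁻ (off a) a∈))) (sym (like-y (others b (does⁻ (off b) b∈))))))
    , 2≤count {p = does ∘ off} (does⁺ (off x) x≢z) (does⁺ (off y) y≢z) x≢y
    , z , does-false⁺ (off z) λ z≢z → z≢z refl)
    where
    off : ∀ w → Dec (w ≢ z)
    off w = ¬? (w ≟ z)
    like-y : ∀ {w} → w ≡ x ⊎ w ≡ y → adj H w z ≡ adj H y z
    like-y (inj₁ refl) = eq
    like-y (inj₂ refl) = refl
small-or-primitive (suc (suc (suc (suc m)))) H none _ = inj₂ (s≤s (s≤s (s≤s (s≤s z≤n))) , trivial)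
  where
  trivial : ∀ M → IsModule H M → count M ≤ 1 ⊎ (∀ v → M v ≡ true)
  trivial M mod with 2 ℕ.≤? count M
  ... | no  ≱2 = inj₁ (ℕ.≤-pred (ℕ.≰⇒> ≱2))
  ... | yes ≥2 = inj₂ λ v → decidable-stable (M v Bool.≟ true) λ ¬Mv → none M (mod , ≥2 , v , ¬true⇒false ¬Mv)

-- Assembling the network along modules

Hereditary : ∀ {n} → Graph n → Set
Hereditary {n} G = ∀ m (f : Embedding m n) →
  Primitive (induced G (proj₁ f)) → PseudoCograph (induced G (proj₁ f))

module Construction {n} (G : Graph n) (pseudo : Hereditary G) where

  -- `X₁` is the quotient, with `a` standing for `M`. Both recursive calls are on smaller sets, as
  -- `X₁` loses `b` and `M` misses `z`, and on sets of at least two elements, `a` and `z` or `a` and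
  -- `b`.
  build : ∀ fuel X → count X ≤ fuel → 2 ≤ count X → Net G X
  build zero X c≤ 2≤c with () ← ℕ.≤-trans 2≤c c≤
  build (suc fuel) X c≤ 2≤c with search-module (induced G (enum X))
  ... | inj₂ none with small-or-primitive _ (induced G (enum X)) none 2≤c
  ...   | inj₂ prim = CycleNet.net G X (cycle-along-enum G X
          (primitive⇒cycle (induced G (enum X)) prim (pseudo _ (enum X , enum-injective X) prim)))
  ...   | inj₁ two with 2≤count⁻ X 2≤c
  ...     | x , y , Xx , Xy , x≢y = pair-net G X Xx Xy x≢y λ z Xz → count≡2⁻ {p = X} two Xx Xy x≢y Xz
  build (suc fuel) X c≤ 2≤c | inj₁ (M′ , mod , two , z′ , M′z) with 2≤count⁻ M′ two
  ... | a′ , b′ , M′a , M′b , a′≢b′ = Substitution.net G X X₁ M a Ma X₁a M⊆X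
        (λ x X₁x x≢a → let Xx , out = does⁻ (X₁? x) X₁x in
          Xx , Sum.fromInj₁ (λ x≡a → contradiction x≡a x≢a) out)
        (λ x Xx Mx → does⁺ (X₁? x) (Xx , inj₁ Mx)) M-module
        (build fuel X₁ (smaller (count-mono-< b X₁⊆X X₁b (enum-sound X b′)))
          (2≤count {p = X₁} X₁a (does⁺ (X₁? z) (enum-sound X z′ , inj₁ Mz)) a≢z))
        (build fuel M (smaller (count-mono-< z M⊆X Mz (enum-sound X z′)))
          (2≤count {p = M} Ma Mb a≢b))
    where
    a b z : Fin n
    a = enum X a′
    b = enum X b′
    z = enum X z′

    M? : ∀ x → Dec (∃ λ i → enum X i ≡ x × M′ i ≡ true)
    M? x = Fin.any? λ i → (enum X i ≟ x) ×-dec (M′ i Bool.≟ true)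

    M : Fin n → Bool
    M x = does (M? x)

    X₁? : ∀ x → Dec (X x ≡ true × (M x ≡ false ⊎ x ≡ a))
    X₁? x = (X x Bool.≟ true) ×-dec ((M x Bool.≟ false) ⊎-dec (x ≟ a))

    X₁ : Fin n → Bool
    X₁ x = does (X₁? x)

    Ma : M a ≡ true
    Ma = does⁺ (M? a) (a′ , refl , M′a)

    Mb : M b ≡ true
    Mb = does⁺ (M? b) (b′ , refl , M′b)

    out : ∀ {i} → M′ i ≡ false → M (enum X i) ≡ false
    out {i} ¬M′i = does-false⁺ (M? (enum X i)) λ (j , eq , M′j) →
      true≢false (trans (sym M′j) (trans (cong M′ (enum-injective X eq)) ¬M′i))

    Mz : M z ≡ false
    Mz = out M′z

    a≢b : a ≢ b
    a≢b = a′≢b′ ∘ enum-injective X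

    a≢z : a ≢ z
    a≢z a≡z = true≢false (trans (sym Ma) (trans (cong M a≡z) Mz))

    X₁a : X₁ a ≡ true
    X₁a = does⁺ (X₁? a) (enum-sound X a′ , inj₂ refl)

    X₁b : X₁ b ≡ false
    X₁b = does-false⁺ (X₁? b) λ
      { (_ , inj₁ ¬Mb) → true≢false (trans (sym Mb) ¬Mb) ; (_ , inj₂ b≡a) → a≢b (sym b≡a) }

    X₁⊆X : X₁ ⊆B X
    X₁⊆X x X₁x = proj₁ (does⁻ (X₁? x) X₁x)

    M⊆X : M ⊆B X
    M⊆X x Mx with does⁻ (M? x) Mx
    ... | i , refl , _ = enum-sound X i

    smaller : ∀ {Y : Fin n → Bool} → count Y < count X → count Y ≤ fuel
    smaller lt = ℕ.≤-pred (ℕ.≤-trans lt c≤)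

    M-module : ∀ x y w → M x ≡ true → M y ≡ true → X w ≡ true → M w ≡ false → adj G x w ≡ adj G y w
    M-module x y w Mx My Xw Mw with does⁻ (M? x) Mx | does⁻ (M? y) My | enum-complete X w Xw
    ... | i , refl , M′i | j , refl , M′j | l , refl =
          mod i j l M′i M′j (¬true⇒false λ M′l → true≢false (trans (sym (does⁺ (M? w) (l , refl , M′l))) Mw))

-- The root of a `Net` has two children, so the one-vertex graph needs the degenerate galled-tree.
singleton-GaTEx : (G : Graph 1) → GaTEx G
singleton-GaTEx G = 1 , (λ _ _ → false) , id , (λ _ → l⊙) ,
  (id , ℕ.≤-refl , (λ _ _ ()) , inj₁ (refl , (λ v → v , refl) , λ _ _ → refl)) ,
  (λ v → mk⇔ (λ _ → v , refl) (λ _ → refl)) ,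
  λ { zero zero i≢i → contradiction refl i≢i }

mainTheorem2 : ∀ (n : ℕ) (G : Graph n) → 1 ≤ n →
    (GaTEx G ⇔
      (∀ (m : ℕ) (f : Embedding m n) →
         Primitive (induced G (proj₁ f)) →
         PseudoCograph (induced G (proj₁ f))))
mainTheorem2 n G 1≤n = mk⇔ (GaTEx⇒pseudoCographs G) (from n G 1≤n)
  where
  from : ∀ n (G : Graph n) → 1 ≤ n → Hereditary G → GaTEx G
  from (suc zero) G _ _ = singleton-GaTEx G
  from (suc (suc n)) G 1≤n pseudo = ToGalledTree.gaTEx 1≤n G
    (Construction.build G pseudo (suc (suc n)) (λ _ → true) (count≤k {suc (suc n)} (λ _ → true))
      (subst (2 ≤_) (sym (count-all {suc (suc n)} {λ _ → true} λ _ → refl)) (s≤s (s≤s z≤n))))
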